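{- Let $\mathcal{S}$ be a simple non-trivial set system on a finite nonempty universe $V$ in which each set has cardinality at most $k\ge 2$ and each element of $V$ appears in at most $\Delta$ sets. Then $$\mathsf{pdim}(\mathcal{S}^{\downarrow})\le (k\Delta)^{O(1)},$$ where the $O(1)$ is an absolute constant. Furthermore, an embedding realizing this bound can be found in time polynomial in $|V|$.
   Context: A set system (set family) on a universe $V$ is a collection of subsets of $V$. It is simple if any two distinct sets in it intersect in at most one element, and non-trivial if every $v\in V$ belongs to at least one set of the family. $\mathcal{S}^{\downarrow}=\{T\subseteq V: T\subseteq S\text{ for some }S\in\mathcal{S}\}$ is the downward closure. For $f:V\to[0,1]^K$ and $S\subseteq V$, write $f(S)=\sum_{v\in S}f(v)$. The packing dimension $\mathsf{pdim}(\mathcal{F})$ of a set family $\mathcal{F}$ on $V$ is the smallest positive integer $K$ for which there is an embedding $f:V\to[0,1]^K$ such that for every $S\subseteq V$: $S\in\mathcal{F}$ if and only if $\lVert f(S)\rVert_\infty\le 1$. If no such embedding exists for any $K$, $\mathsf{pdim}(\mathcal{F})$ is infinite. -}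

module Defs where

open import Data.Bool.Base using (Bool; true; false; if_then_else_)
open import Data.Digit using (Bit; Expansion; fromDigits)
open import Data.Fin.Base using (Fin; zero; suc)
open import Data.Fin.Subset using (Subset; _∈_; _⊆_; _∩_; ∣_∣)
open import Data.Fin.Subset.Properties using (_∈?_)
open import Data.List.Base using (List; []; _∷_; length; filter)
open import Data.List.Membership.Propositional using () renaming (_∈_ to _∈ˡ_)
open import Data.List.Relation.Unary.Unique.Propositional using (Unique)
open import Data.Nat.Base as ℕ using (ℕ; zero; suc)
open import Data.Nat.Induction using (<-rec)
import Data.Nat.Properties as ℕ
open import Data.Integer.Base using (+_)
open import Data.Product.Base using (Σ; ∃; _×_; _,_)
open import Data.Rational.Base as ℚ using (ℚ; 0ℚ; 1ℚ; ½)
import Data.Rational.Properties as ℚ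
import Data.Rational.Solver as ℚSolver
open import Data.Sum.Base using (inj₁; inj₂)
open import Data.Vec.Base as Vec using (Vec; []; _∷_; lookup)
open import Data.Vec.Functional as Vector using (Vector)
open import Function.Bundles using (_⇔_)
open import Level using (0ℓ)
open import Relation.Binary.PropositionalEquality
  using (_≡_; _≢_; refl; sym; trans; cong; subst; subst₂)
open import Relation.Nullary using (¬_)
open import Relation.Unary using (Pred)

open ℚSolver.+-*-Solver using (solve; _:=_; _:+_; _:-_; :-_)

private
  variable
    n K : ℕ

------------------------------------------------------------------------
-- Real numbers, as Cauchy sequences of rationals.  Equality of reals is
-- never needed below, only the order.

Cauchy : (ℕ → ℚ) → Set
Cauchy x = ∀ ε → 0ℚ ℚ.< ε → ∃ λ N → ∀ i j → N ℕ.≤ i → N ℕ.≤ j →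
           ℚ.∣ x i ℚ.- x j ∣ ℚ.< ε

record ℝ : Set where
  constructor mkℝ
  field
    seq    : ℕ → ℚ
    cauchy : Cauchy seq

open ℝ public

infix 4 _≤ℝ_

_≤ℝ_ : ℝ → ℝ → Set
x ≤ℝ y = ∀ ε → 0ℚ ℚ.< ε → ∃ λ N → ∀ i → N ℕ.≤ i →
         seq x i ℚ.≤ seq y i ℚ.+ ε

private
  Nonexpansive₂ : (ℚ → ℚ → ℚ) → Set
  Nonexpansive₂ _∙_ = ∀ p q r s →
    ℚ.∣ (p ∙ q) ℚ.- (r ∙ s) ∣ ℚ.≤ ℚ.∣ p ℚ.- r ∣ ℚ.+ ℚ.∣ q ℚ.- s ∣

private abstract

  halves : ∀ ε → ½ ℚ.* ε ℚ.+ ½ ℚ.* ε ≡ ε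
  halves ε = trans (sym (ℚ.*-distribʳ-+ ε ½ ½)) (ℚ.*-identityˡ ε)

  half-pos : ∀ ε → 0ℚ ℚ.< ε → 0ℚ ℚ.< ½ ℚ.* ε
  half-pos ε 0<ε = ℚ.positive⁻¹ (½ ℚ.* ε)
    {{ℚ.pos*pos⇒pos ½ ε {{ℚ.positive 0<ε}}}}

  p≤∣p∣ : ∀ p → p ℚ.≤ ℚ.∣ p ∣
  p≤∣p∣ p with ℚ.≤-total 0ℚ p
  ... | inj₁ 0≤p = ℚ.≤-reflexive (sym (ℚ.0≤p⇒∣p∣≡p 0≤p))
  ... | inj₂ p≤0 = ℚ.≤-trans p≤0 (ℚ.0≤∣p∣ p)

  ∣p-q∣≤ : ∀ {p q r} → p ℚ.≤ q ℚ.+ r → q ℚ.≤ p ℚ.+ r → ℚ.∣ p ℚ.- q ∣ ℚ.≤ r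
  ∣p-q∣≤ {p} {q} {r} p≤ q≤ with ℚ.∣p∣≡p∨∣p∣≡-p (p ℚ.- q)
  ... | inj₁ e = subst (ℚ._≤ r) (sym e)
    (subst (p ℚ.- q ℚ.≤_)
      (solve 2 (λ q r → q :+ r :- q := r) refl q r)
      (ℚ.+-monoˡ-≤ (ℚ.- q) p≤))
  ... | inj₂ e = subst (ℚ._≤ r) (sym e)
    (subst₂ ℚ._≤_
      (solve 2 (λ p q → q :- p := :- (p :- q)) refl p q)
      (solve 2 (λ p r → p :+ r :- p := r) refl p r)
      (ℚ.+-monoˡ-≤ (ℚ.- p) q≤))

  q≤p+∣p-q∣ : ∀ p q → q ℚ.≤ p ℚ.+ ℚ.∣ p ℚ.- q ∣
  q≤p+∣p-q∣ p q = subst₂ ℚ._≤_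
    (solve 2 (λ p q → p :+ (:- (p :- q)) := q) refl p q)
    (cong (p ℚ.+_) (ℚ.∣-p∣≡∣p∣ (p ℚ.- q)))
    (ℚ.+-monoʳ-≤ p (p≤∣p∣ (ℚ.- (p ℚ.- q))))

  p≤q+∣p-q∣ : ∀ p q → p ℚ.≤ q ℚ.+ ℚ.∣ p ℚ.- q ∣
  p≤q+∣p-q∣ p q = subst (ℚ._≤ q ℚ.+ ℚ.∣ p ℚ.- q ∣)
    (solve 2 (λ p q → q :+ (p :- q) := p) refl p q)
    (ℚ.+-monoʳ-≤ q (p≤∣p∣ (p ℚ.- q)))

  cauchy₂ : ∀ (f : ℚ → ℚ → ℚ) → Nonexpansive₂ f →
            ∀ x y → Cauchy (λ i → f (seq x i) (seq y i))
  cauchy₂ f nonexp x y ε 0<ε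
    with cauchy x (½ ℚ.* ε) (half-pos ε 0<ε)
       | cauchy y (½ ℚ.* ε) (half-pos ε 0<ε)
  ... | M , hx | N , hy = M ℕ.⊔ N , λ i j Mi Mj →
    ℚ.≤-<-trans (nonexp (seq x i) (seq y i) (seq x j) (seq y j))
      (subst (_ ℚ.<_) (halves ε)
        (ℚ.+-mono-<
          (hx i j (ℕ.m⊔n≤o⇒m≤o M N Mi) (ℕ.m⊔n≤o⇒m≤o M N Mj))
          (hy i j (ℕ.m⊔n≤o⇒n≤o M N Mi) (ℕ.m⊔n≤o⇒n≤o M N Mj))))

  +-nonexpansive : Nonexpansive₂ ℚ._+_
  +-nonexpansive p q r s = subst
    (λ u → ℚ.∣ u ∣ ℚ.≤ ℚ.∣ p ℚ.- r ∣ ℚ.+ ℚ.∣ q ℚ.- s ∣)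
    (solve 4 (λ p q r s → (p :- r) :+ (q :- s) := (p :+ q) :- (r :+ s))
      refl p q r s)
    (ℚ.∣p+q∣≤∣p∣+∣q∣ (p ℚ.- r) (q ℚ.- s))

  ⊔-nonexpansive : Nonexpansive₂ ℚ._⊔_
  ⊔-nonexpansive p q r s = ∣p-q∣≤
    (ℚ.⊔-lub (side₁ (p≤q+∣p-q∣ p r) (ℚ.p≤p⊔q r s))
             (side₂ (p≤q+∣p-q∣ q s) (ℚ.p≤q⊔p r s)))
    (ℚ.⊔-lub (side₁ (q≤p+∣p-q∣ p r) (ℚ.p≤p⊔q p q))
             (side₂ (q≤p+∣p-q∣ q s) (ℚ.p≤q⊔p p q)))
    where
    d e : ℚ
    d = ℚ.∣ p ℚ.- r ∣
    e = ℚ.∣ q ℚ.- s ∣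
    d≤d+e : d ℚ.≤ d ℚ.+ e
    d≤d+e = subst (ℚ._≤ d ℚ.+ e) (ℚ.+-identityʳ d)
      (ℚ.+-monoʳ-≤ d (ℚ.0≤∣p∣ (q ℚ.- s)))
    e≤d+e : e ℚ.≤ d ℚ.+ e
    e≤d+e = subst (ℚ._≤ d ℚ.+ e) (ℚ.+-identityˡ e)
      (ℚ.+-monoˡ-≤ e (ℚ.0≤∣p∣ (p ℚ.- r)))
    side₁ : ∀ {a b c} → a ℚ.≤ b ℚ.+ d → b ℚ.≤ c → a ℚ.≤ c ℚ.+ (d ℚ.+ e)
    side₁ h b≤c = ℚ.≤-trans h (ℚ.+-mono-≤ b≤c d≤d+e)
    side₂ : ∀ {a b c} → a ℚ.≤ b ℚ.+ e → b ℚ.≤ c → a ℚ.≤ c ℚ.+ (d ℚ.+ e)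
    side₂ h b≤c = ℚ.≤-trans h (ℚ.+-mono-≤ b≤c e≤d+e)

  ∣∣-nonexpansive : ∀ p q → ℚ.∣ ℚ.∣ p ∣ ℚ.- ℚ.∣ q ∣ ∣ ℚ.≤ ℚ.∣ p ℚ.- q ∣
  ∣∣-nonexpansive p q = ∣p-q∣≤
    (subst₂ ℚ._≤_
      (cong ℚ.∣_∣ (solve 2 (λ p q → q :+ (p :- q) := p) refl p q)) refl
      (ℚ.∣p+q∣≤∣p∣+∣q∣ q (p ℚ.- q)))
    (subst₂ ℚ._≤_
      (cong ℚ.∣_∣ (solve 2 (λ p q → p :+ :- (p :- q) := q) refl p q))
      (cong (ℚ.∣ p ∣ ℚ.+_) (ℚ.∣-p∣≡∣p∣ (p ℚ.- q)))
      (ℚ.∣p+q∣≤∣p∣+∣q∣ p (ℚ.- (p ℚ.- q))))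

  cauchy-const : ∀ q → Cauchy (λ _ → q)
  cauchy-const q ε 0<ε = 0 , λ _ _ _ _ →
    subst (λ r → ℚ.∣ r ∣ ℚ.< ε) (sym (ℚ.+-inverseʳ q)) 0<ε

  cauchy-∣∣ : ∀ x → Cauchy (λ i → ℚ.∣ seq x i ∣)
  cauchy-∣∣ x ε 0<ε with cauchy x ε 0<ε
  ... | N , h = N , λ i j Ni Nj →
    ℚ.≤-<-trans (∣∣-nonexpansive (seq x i) (seq x j)) (h i j Ni Nj)

fromℚ : ℚ → ℝ
fromℚ q = mkℝ (λ _ → q) (cauchy-const q)

0ℝ 1ℝ : ℝ
0ℝ = fromℚ 0ℚ
1ℝ = fromℚ 1ℚ

infixl 6 _+ℝ_ _⊔ℝ_

_+ℝ_ _⊔ℝ_ : ℝ → ℝ → ℝ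
x +ℝ y = mkℝ (λ i → seq x i ℚ.+ seq y i) (cauchy₂ ℚ._+_ +-nonexpansive x y)
x ⊔ℝ y = mkℝ (λ i → seq x i ℚ.⊔ seq y i) (cauchy₂ ℚ._⊔_ ⊔-nonexpansive x y)

∣_∣ℝ : ℝ → ℝ
∣ x ∣ℝ = mkℝ (λ i → ℚ.∣ seq x i ∣) (cauchy-∣∣ x)

-- Starting the maximum at 0 is harmless, since absolute values are
-- nonnegative.
‖_‖∞ : Vector ℝ K → ℝ
‖ x ‖∞ = Vector.foldr (λ a m → ∣ a ∣ℝ ⊔ℝ m) 0ℝ x

------------------------------------------------------------------------
-- Set families on the universe Fin n.

Family : ℕ → Set₁
Family n = Pred (Subset n) 0ℓ

-- A set system, listed without repetition.
record SetSystem (n : ℕ) : Set where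
  constructor mkSetSystem
  field
    sets     : List (Subset n)
    distinct : Unique sets

open SetSystem public

Simple : SetSystem n → Set
Simple 𝒮 = ∀ {A B} → A ∈ˡ sets 𝒮 → B ∈ˡ sets 𝒮 → A ≢ B → ∣ A ∩ B ∣ ℕ.≤ 1

NonTrivial : SetSystem n → Set
NonTrivial {n} 𝒮 = ∀ (v : Fin n) → ∃ λ A → A ∈ˡ sets 𝒮 × v ∈ A

SetsOfSize≤ : ℕ → SetSystem n → Set
SetsOfSize≤ k 𝒮 = ∀ {A} → A ∈ˡ sets 𝒮 → ∣ A ∣ ℕ.≤ k

degree : SetSystem n → Fin n → ℕ
degree 𝒮 v = length (filter (v ∈?_) (sets 𝒮))

Degree≤ : ℕ → SetSystem n → Set
Degree≤ {n} Δ 𝒮 = ∀ (v : Fin n) → degree 𝒮 v ℕ.≤ Δ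

infix 8 _↓

_↓ : SetSystem n → Family n
(𝒮 ↓) T = ∃ λ A → A ∈ˡ sets 𝒮 × T ⊆ A

------------------------------------------------------------------------
-- Packing dimension

-- f(T) = Σ_{v ∈ T} f(v)
sumOver : (Fin n → Vector ℝ K) → Subset n → Vector ℝ K
sumOver f T i =
  Vector.foldr _+ℝ_ 0ℝ (λ v → if lookup T v then f v i else 0ℝ)

record IsEmbedding (F : Family n) (f : Fin n → Vector ℝ K) : Set where
  field
    unit-cube : ∀ v i → 0ℝ ≤ℝ f v i × f v i ≤ℝ 1ℝ
    packs     : ∀ T → F T ⇔ (‖ sumOver f T ‖∞ ≤ℝ 1ℝ)

Embeddable : Family n → ℕ → Set
Embeddable {n} F K = Σ (Fin n → Vector ℝ K) (IsEmbedding F)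

record IsPdim (F : Family n) (d : ℕ) : Set where
  field
    positive   : 1 ℕ.≤ d
    embeddable : Embeddable F d
    least      : ∀ K → 1 ℕ.≤ K → Embeddable F K → d ℕ.≤ K

-- "pdim F ≤ N", where pdim F is the least positive K with Embeddable F K
-- (infinite if there is none).  Selecting that least K is not
-- constructive for real embeddings; the three lemmas below relate the
-- bound to the minimum.
PdimAtMost : Family n → ℕ → Set
PdimAtMost F N = ∃ λ K → 1 ℕ.≤ K × K ℕ.≤ N × Embeddable F K

IsPdim⇒PdimAtMost : ∀ {F : Family n} {d N} →
                    IsPdim F d → d ℕ.≤ N → PdimAtMost F N
IsPdim⇒PdimAtMost {d = d} p d≤N = d , positive , d≤N , embeddable
  where open IsPdim p

PdimAtMost⇒≤ : ∀ {F : Family n} {d N} →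
               PdimAtMost F N → IsPdim F d → d ℕ.≤ N
PdimAtMost⇒≤ (K , 1≤K , K≤N , e) p = ℕ.≤-trans (IsPdim.least p K 1≤K e) K≤N

PdimAtMost⇒¬¬IsPdim : ∀ {F : Family n} {N} → PdimAtMost F N →
                      ¬ ¬ (∃ λ d → IsPdim F d × d ℕ.≤ N)
PdimAtMost⇒¬¬IsPdim {n} {F} {N} (K , 1≤K , K≤N , e) none =
  <-rec (λ K → 1 ℕ.≤ K → K ℕ.≤ N → ¬ Embeddable F K) step K 1≤K K≤N e
  where
  step : ∀ K → (∀ {J} → J ℕ.< K → 1 ℕ.≤ J → J ℕ.≤ N → ¬ Embeddable F J) →
         1 ℕ.≤ K → K ℕ.≤ N → ¬ Embeddable F K
  step K rec 1≤K K≤N e = none (K , record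
    { positive   = 1≤K
    ; embeddable = e
    ; least      = λ J 1≤J e′ → ℕ.≮⇒≥ λ J<K →
        rec J<K 1≤J (ℕ.≤-trans (ℕ.<⇒≤ J<K) K≤N) e′
    } , K≤N)

------------------------------------------------------------------------
-- Model of computation: a while-language over binary trees, with
-- call-by-value semantics.  Each evaluation rule is charged one unit.
-- With trees stored as pointers (so that `node` shares its components)
-- every rule takes constant time on a RAM for a fixed program, and
-- conversely Turing machines are simulated step by step, so that
-- polynomial time here is polynomial time in the usual sense.  Sharing
-- cannot hide large outputs: the length of any list in a value grows by at
-- most one per `node`, so nested lists of digits built in polynomial time
-- have polynomial size when written out.

data Tree : Set where
  leaf : Tree
  node : Tree → Tree → Tree

-- Expressions with m free variables (de Bruijn indices).
--   case e a b  : a if e is a leaf, b with both subtrees bound (the left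
--                 one has index 0, the right one index 1) if it is a node
--   while c b e : start from x := e; as long as c(x) is not a leaf,
--                 x := b(x); return x
data Exp (m : ℕ) : Set where
  var   : Fin m → Exp m
  leaf  : Exp m
  node  : Exp m → Exp m → Exp m
  let′  : Exp m → Exp (suc m) → Exp m
  case  : Exp m → Exp m → Exp (suc (suc m)) → Exp m
  while : Exp (suc m) → Exp (suc m) → Exp m → Exp m

infix 4 _⊢_⇓_⟨_⟩ _⊢loop_body_from_⇓_⟨_⟩

mutual

  -- ρ ⊢ e ⇓ v ⟨ t ⟩ : in environment ρ, e evaluates to v in t steps.
  data _⊢_⇓_⟨_⟩ {m} (ρ : Vec Tree m) : Exp m → Tree → ℕ → Set where
    var⇓ : ∀ {i} → ρ ⊢ var i ⇓ lookup ρ i ⟨ 1 ⟩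
    leaf⇓ : ρ ⊢ leaf ⇓ leaf ⟨ 1 ⟩
    node⇓ : ∀ {a b u v s t} →
            ρ ⊢ a ⇓ u ⟨ s ⟩ → ρ ⊢ b ⇓ v ⟨ t ⟩ →
            ρ ⊢ node a b ⇓ node u v ⟨ 1 ℕ.+ s ℕ.+ t ⟩
    let⇓ : ∀ {a b u v s t} →
           ρ ⊢ a ⇓ u ⟨ s ⟩ → u ∷ ρ ⊢ b ⇓ v ⟨ t ⟩ →
           ρ ⊢ let′ a b ⇓ v ⟨ 1 ℕ.+ s ℕ.+ t ⟩
    case-leaf⇓ : ∀ {e a b v s t} →
                 ρ ⊢ e ⇓ leaf ⟨ s ⟩ → ρ ⊢ a ⇓ v ⟨ t ⟩ →
                 ρ ⊢ case e a b ⇓ v ⟨ 1 ℕ.+ s ℕ.+ t ⟩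
    case-node⇓ : ∀ {e a b l r v s t} →
                 ρ ⊢ e ⇓ node l r ⟨ s ⟩ → l ∷ r ∷ ρ ⊢ b ⇓ v ⟨ t ⟩ →
                 ρ ⊢ case e a b ⇓ v ⟨ 1 ℕ.+ s ℕ.+ t ⟩
    while⇓ : ∀ {c b e u v s t} →
             ρ ⊢ e ⇓ u ⟨ s ⟩ → ρ ⊢loop c body b from u ⇓ v ⟨ t ⟩ →
             ρ ⊢ while c b e ⇓ v ⟨ 1 ℕ.+ s ℕ.+ t ⟩

  data _⊢loop_body_from_⇓_⟨_⟩ {m} (ρ : Vec Tree m) (c b : Exp (suc m)) :
         Tree → Tree → ℕ → Set where
    done : ∀ {x s} →
           x ∷ ρ ⊢ c ⇓ leaf ⟨ s ⟩ →
           ρ ⊢loop c body b from x ⇓ x ⟨ 1 ℕ.+ s ⟩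
    step : ∀ {x y z l r s t u} →
           x ∷ ρ ⊢ c ⇓ node l r ⟨ s ⟩ → x ∷ ρ ⊢ b ⇓ y ⟨ t ⟩ →
           ρ ⊢loop c body b from y ⇓ z ⟨ u ⟩ →
           ρ ⊢loop c body b from x ⇓ z ⟨ 1 ℕ.+ s ℕ.+ t ℕ.+ u ⟩

------------------------------------------------------------------------
-- Input and output formats

encodeBool : Bool → Tree
encodeBool false = leaf
encodeBool true  = node leaf leaf

encodeBit : Bit → Tree
encodeBit zero       = leaf
encodeBit (suc zero) = node leaf leaf

encodeList : ∀ {A : Set} → (A → Tree) → List A → Tree
encodeList enc []       = leaf
encodeList enc (x ∷ xs) = node (enc x) (encodeList enc xs)

encodeVec : ∀ {A : Set} → (A → Tree) → Vec A n → Tree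
encodeVec enc xs = encodeList enc (Vec.toList xs)

-- A set system is given as the list of the incidence vectors of its sets,
-- preceded by the universe size in unary.
encodeSystem : SetSystem n → Tree
encodeSystem {n} 𝒮 =
  node (encodeVec encodeBool (Vec.replicate n false))
       (encodeList (encodeVec encodeBool) (sets 𝒮))

-- Fractions in binary, least significant bit first; neither leading zeros
-- nor common factors are excluded.
record BinaryFraction : Set where
  constructor mkFraction
  field
    num den  : Expansion 2
    .nonzero : ℕ.NonZero (fromDigits den)

value : BinaryFraction → ℚ
value (mkFraction num den nonzero) =
  (+ fromDigits num ℚ./ fromDigits den) {{nonzero}}

encodeFraction : BinaryFraction → Tree
encodeFraction (mkFraction num den _) =
  node (encodeList encodeBit num) (encodeList encodeBit den)

-- One row for each element of the universe, holding its K coordinates.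
encodeMatrix : Vec (Vec BinaryFraction K) n → Tree
encodeMatrix = encodeVec (encodeVec encodeFraction)

realMap : Vec (Vec BinaryFraction K) n → Fin n → Vector ℝ K
realMap M v i = fromℚ (value (lookup (lookup M v) i))

{-# OPTIONS --safe #-}

-- Colour the universe greedily so that elements at distance at most two in
-- the graph "lie in a common set" get distinct colours; (kΔ)² + 1 colours
-- suffice.  A subset lies outside the family iff it contains two elements
-- without a common set or three elements that only pairwise have one, and
-- each kind is excluded by coordinates indexed by colours.
--
-- Pairs.  Write D = 2ⁿ - 1 and give every element u a number x(u) ≤ D.  For
-- colours a ≠ b, an element u of colour a gets x(u)/D, and an element v of
-- colour b gets 1 - x(u′)/D, where u′ is the unique element of colour a
-- that shares a set with v, or 1 if there is none.  Sets sum to at most 1,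
-- while u, v sum to more than 1 if x(u) > x(u′).  Using both x and D - x,
-- it is enough that x be injective; x(u) = 2^u makes every numerator a list
-- of n bits, each given by a simple formula.  For a = b, all elements of
-- that colour get 1.
--
-- Triples.  For colours a, b, c the elements of the excluded triples with
-- these colours get 1/2.  A set contains at most two of them: otherwise the
-- distance-two colouring makes it contain a whole excluded triple.
module Submission where

open import Defs
open import Data.Bool.Base using (Bool; true; false; if_then_else_; _∧_; _∨_; not; T)
open import Data.Bool.ListAction using (any)
import Data.Bool.Properties as Bool
open import Data.Digit using (Bit; fromDigits)
open import Data.Empty using (⊥; ⊥-elim)
open import Data.Fin.Base as Fin using (Fin; zero; suc; toℕ; _↑ʳ_)
open import Data.Fin.Patterns using (0F; 1F; 3F)
import Data.Fin.Properties as Finₚ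
open import Data.Fin.Subset as Subset using (Subset; _∈_; ∣_∣)
import Data.Fin.Subset.Properties as Subset
open import Data.Integer.Base as ℤ using (+_)
import Data.Integer.Properties as ℤ
open import Data.List.Base as List using (List; []; _∷_; length; concatMap; filter; map)
import Data.List.Properties as List
open import Data.List.Membership.Propositional using (lose; find) renaming (_∈_ to _∈ˡ_)
import Data.List.Membership.Propositional.Properties as Membership
open import Data.List.Relation.Unary.All as All using ([]; _∷_)
import Data.List.Relation.Unary.All.Properties as All
open import Data.List.Relation.Unary.AllPairs using ([]; _∷_)
open import Data.List.Relation.Unary.Any as Any using (here; there)
import Data.List.Relation.Unary.Any.Properties as Any
open import Data.List.Relation.Unary.Unique.Propositional using (Unique)
import Data.List.Relation.Unary.Unique.Propositional.Properties as Unique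
open import Data.Nat.Base as ℕ using (ℕ; zero; suc; _+_; _*_; _^_; _≤_; _<_; z≤n; s≤s; _<ᵇ_)
import Data.Nat.Properties as ℕ
import Data.Nat.Solver as ℕSolver
open import Data.Product.Base using (Σ; ∃; _×_; _,_; proj₁; proj₂)
open import Data.Rational.Base as ℚ using (ℚ; 0ℚ; 1ℚ)
import Data.Rational.Properties as ℚ
open import Data.Rational.Unnormalised.Base as ℚᵘ using (mkℚᵘ; *≡*; *≤*)
import Data.Rational.Unnormalised.Properties as ℚᵘ
open import Data.Sum.Base using (_⊎_; inj₁; inj₂)
open import Data.Vec.Base as Vec using (Vec; []; _∷_; lookup; here; there)
import Data.Vec.Properties as Vec
open import Data.Vec.Functional as Vector using (Vector)
open import Function.Base using (_∘_; id; case_of_)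
open import Function.Bundles using (Equivalence; _⇔_; mk⇔)
open import Relation.Binary.Definitions using (tri<; tri≈; tri>)
open import Relation.Binary.PropositionalEquality
open import Relation.Nullary using (¬_; yes; no; contradiction; ¬?; _×-dec_)
open import Relation.Nullary.Decidable using (decidable-stable)

-- Pairs and triples suffice because of simplicity: two elements of a subset already fix the only
-- set that could contain it, so every further element is tested in a triple with those two.
--
-- The bound on the sum over a set could be obscured by carries. The choice of x avoids them: in a
-- pair coordinate, distinct elements of one set never have a digit 1 in the same position, so the
-- comparison with D is made position by position. The partner u′ is never computed either: a digit
-- of D - x(u′) is the negation of a disjunction over all candidates for u′.
--
-- The exponent 11 is 3 · 3 + 2. With P = kΔ ≥ 2 there are at most P² + 1 ≤ P³ colours, and each of
-- the at most P⁹ triples of colours yields 3 ≤ P² coordinates. Colours not in use must be skipped,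
-- since otherwise K would grow with n.
--
-- Time is bounded first in terms of n and the number of sets. That it is polynomial in n alone
-- again rests on simplicity, which leaves room for at most (n + 1)² sets.

private
  variable
    A B : Set
    m n K : ℕ

-- Evaluation within a time bound

infix 4 _⊢_⇓_within_ _⊢loop_body_from_⇓_within_

_⊢_⇓_within_ : ∀ {m} → Vec Tree m → Exp m → Tree → ℕ → Set
ρ ⊢ e ⇓ v within b = ∃ λ t → t ≤ b × ρ ⊢ e ⇓ v ⟨ t ⟩

_⊢loop_body_from_⇓_within_ :
  ∀ {m} → Vec Tree m → Exp (suc m) → Exp (suc m) → Tree → Tree → ℕ → Set
ρ ⊢loop c body b from x ⇓ y within s =
  ∃ λ t → t ≤ s × ρ ⊢loop c body b from x ⇓ y ⟨ t ⟩

module _ {m} {ρ : Vec Tree m} where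

  var-within : ∀ i {v} → lookup ρ i ≡ v → ρ ⊢ var i ⇓ v within 1
  var-within i refl = 1 , ℕ.≤-refl , var⇓

  leaf-within : ρ ⊢ leaf ⇓ leaf within 1
  leaf-within = 1 , ℕ.≤-refl , leaf⇓

  node-within : ∀ {a b u v p q} → ρ ⊢ a ⇓ u within p → ρ ⊢ b ⇓ v within q →
                ρ ⊢ node a b ⇓ node u v within 1 + p + q
  node-within (_ , s≤p , a⇓) (_ , t≤q , b⇓) =
    _ , s≤s (ℕ.+-mono-≤ s≤p t≤q) , node⇓ a⇓ b⇓

  let-within : ∀ {a b u v p q} → ρ ⊢ a ⇓ u within p → u ∷ ρ ⊢ b ⇓ v within q →
               ρ ⊢ let′ a b ⇓ v within 1 + p + q
  let-within (_ , s≤p , a⇓) (_ , t≤q , b⇓) =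
    _ , s≤s (ℕ.+-mono-≤ s≤p t≤q) , let⇓ a⇓ b⇓

  case-leaf-within : ∀ {e a b v p q} →
                     ρ ⊢ e ⇓ leaf within p → ρ ⊢ a ⇓ v within q →
                     ρ ⊢ case e a b ⇓ v within 1 + p + q
  case-leaf-within (_ , s≤p , e⇓) (_ , t≤q , a⇓) =
    _ , s≤s (ℕ.+-mono-≤ s≤p t≤q) , case-leaf⇓ e⇓ a⇓

  case-node-within : ∀ {e a b l r v p q} →
                     ρ ⊢ e ⇓ node l r within p → l ∷ r ∷ ρ ⊢ b ⇓ v within q →
                     ρ ⊢ case e a b ⇓ v within 1 + p + q
  case-node-within (_ , s≤p , e⇓) (_ , t≤q , b⇓) =
    _ , s≤s (ℕ.+-mono-≤ s≤p t≤q) , case-node⇓ e⇓ b⇓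

  while-within : ∀ {c b e u v p q} →
                 ρ ⊢ e ⇓ u within p → ρ ⊢loop c body b from u ⇓ v within q →
                 ρ ⊢ while c b e ⇓ v within 1 + p + q
  while-within (_ , s≤p , e⇓) (_ , t≤q , l⇓) =
    _ , s≤s (ℕ.+-mono-≤ s≤p t≤q) , while⇓ e⇓ l⇓

  done-within : ∀ {c b x p} → x ∷ ρ ⊢ c ⇓ leaf within p →
                ρ ⊢loop c body b from x ⇓ x within 1 + p
  done-within (_ , s≤p , c⇓) = _ , s≤s s≤p , done c⇓

  step-within : ∀ {c b x y z l r p q o} →
                x ∷ ρ ⊢ c ⇓ node l r within p → x ∷ ρ ⊢ b ⇓ y within q →
                ρ ⊢loop c body b from y ⇓ z within o →
                ρ ⊢loop c body b from x ⇓ z within 1 + p + q + o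
  step-within (_ , s≤p , c⇓) (_ , t≤q , b⇓) (_ , u≤o , l⇓) =
    _ , s≤s (ℕ.+-mono-≤ (ℕ.+-mono-≤ s≤p t≤q) u≤o) , step c⇓ b⇓ l⇓

  weaken-loop : ∀ {c b x y p q} → p ≤ q → ρ ⊢loop c body b from x ⇓ y within p →
                ρ ⊢loop c body b from x ⇓ y within q
  weaken-loop p≤q (t , t≤p , l⇓) = t , ℕ.≤-trans t≤p p≤q , l⇓

  weaken : ∀ {e v p q} → p ≤ q → ρ ⊢ e ⇓ v within p → ρ ⊢ e ⇓ v within q
  weaken p≤q (t , t≤p , e⇓) = t , ℕ.≤-trans t≤p p≤q , e⇓

  value-≡ : ∀ {e u v b} → u ≡ v → ρ ⊢ e ⇓ u within b → ρ ⊢ e ⇓ v within b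
  value-≡ refl e⇓ = e⇓

  loop-≡ : ∀ {c b x y z p} → y ≡ z → ρ ⊢loop c body b from x ⇓ y within p →
           ρ ⊢loop c body b from x ⇓ z within p
  loop-≡ refl l⇓ = l⇓

  -- The times of both branches are added instead of taking the larger one, so that running times
  -- involve only sums and products. Each branch may use the value of the test.
  if-within : ∀ {e a b v o p q} c →
              ρ ⊢ e ⇓ encodeBool c within o →
              (c ≡ false → ρ ⊢ a ⇓ v within p) →
              (∀ {l r} → c ≡ true → l ∷ r ∷ ρ ⊢ b ⇓ v within q) →
              ρ ⊢ case e a b ⇓ v within 1 + o + (p + q)
  if-within {p = p} {q} false e⇓ a⇓ b⇓ =
    weaken (ℕ.+-monoʳ-≤ _ (ℕ.m≤m+n p q)) (case-leaf-within e⇓ (a⇓ refl))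
  if-within {p = p} {q} true e⇓ a⇓ b⇓ =
    weaken (ℕ.+-monoʳ-≤ _ (ℕ.m≤n+m q p)) (case-node-within e⇓ (b⇓ refl))

  encodeBool-within : ∀ b → ρ ⊢ (if b then node leaf leaf else leaf) ⇓
                      encodeBool b within 3
  encodeBool-within false = weaken (s≤s z≤n) leaf-within
  encodeBool-within true  = node-within leaf-within leaf-within

foldFin : ∀ {n} → (Fin n → A → A) → A → A
foldFin g a = Vector.foldr (λ h → h) a g

unary : ℕ → Tree
unary zero    = leaf
unary (suc n) = node leaf (unary n)

-- `foldFin` applies index 0 last, which matches a counter running down from n. Induction on n thus
-- removes the final iteration, and the remainder of the run is passed along as a hypothesis.
loop-foldFin : ∀ {ρ : Vec Tree m} {c b} n (state : ℕ → A → Tree)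
  (g : Fin n → A → A) {p q} →
  (∀ (i : Fin n) a → ∃ λ l → ∃ λ r → state (suc (toℕ i)) a ∷ ρ ⊢ c ⇓ node l r within p) →
  (∀ (i : Fin n) a → state (suc (toℕ i)) a ∷ ρ ⊢ b ⇓ state (toℕ i) (g i a) within q) →
  ∀ {a z o} →
  ρ ⊢loop c body b from state 0 (foldFin g a) ⇓ z within o →
  ρ ⊢loop c body b from state n a ⇓ z within n * (1 + p + q) + o
loop-foldFin zero state g c⇓ b⇓ rest = rest
loop-foldFin (suc n) state g {p} {q} c⇓ b⇓ {a} {o = o} rest =
  weaken-loop
    (ℕ.≤-reflexive (begin
      n * (1 + p + q) + (1 + p + q + o)   ≡⟨ ℕ.+-assoc (n * (1 + p + q)) (1 + p + q) o ⟨
      n * (1 + p + q) + (1 + p + q) + o   ≡⟨ cong (_+ o) (ℕ.+-comm (n * (1 + p + q)) _) ⟩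
      suc n * (1 + p + q) + o             ∎))
    (loop-foldFin n (state ∘ suc) (g ∘ suc) (c⇓ ∘ suc) (b⇓ ∘ suc)
      (step-within (proj₂ (proj₂ (c⇓ zero _))) (b⇓ zero _) rest))
  where open ≡-Reasoning

leftChild : Exp (suc m)
leftChild = case (var 0F) leaf (var 0F)

leftChild-within : ∀ {ρ : Vec Tree m} {l r} → node l r ∷ ρ ⊢ leftChild ⇓ l within 3
leftChild-within = case-node-within (var-within 0F refl) (var-within 0F refl)

-- countdown s body init: the state is a counter, initially the value of
-- the variable s, paired with an accumulator.  In body the decreased
-- counter has index 1 and the accumulator index 3.
countdown : Fin m → Exp (5 + m) → Exp m → Exp m
countdown s body init =
  case (while leftChild
         (case (var 0F) leaf (case (var 0F) leaf (node (var 1F) body)))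
         (node (var s) init))
    leaf (var 1F)

frame : ℕ → Tree → Vec Tree m → Vec Tree (5 + m)
frame i t ρ = leaf ∷ unary i ∷ unary (suc i) ∷ t ∷ node (unary (suc i)) t ∷ ρ

-- An iteration costs 1 for the rule, 3 for the test, and 6 + q for unpacking the state and
-- rebuilding it around the body; leaving the loop costs 1 + 3.
countdownTime : ℕ → ℕ → ℕ → ℕ
countdownTime X p q = 1 + (1 + (2 + p) + (X * (10 + q) + 4)) + 1

countdown-within : ∀ {ρ : Vec Tree m} {s init} {body : Exp (5 + m)} {n X p q}
  (enc : A → Tree) (g : Fin n → A → A) {a} →
  lookup ρ s ≡ unary n → n ≤ X →
  ρ ⊢ init ⇓ enc a within p →
  (∀ i a → frame (toℕ i) (enc a) ρ ⊢ body ⇓ enc (g i a) within q) →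
  ρ ⊢ countdown s body init ⇓ enc (foldFin g a) within countdownTime X p q
countdown-within {s = s} {n = n} {X} {p} {q} enc g {a} s≡n n≤X init⇓ body⇓ =
  case-node-within
    (while-within (node-within (var-within s s≡n) init⇓)
      (weaken-loop (ℕ.+-monoˡ-≤ 4 (ℕ.*-monoˡ-≤ (10 + q) n≤X))
        (loop-foldFin n (λ j a → node (unary j) (enc a)) g
          (λ i a → _ , _ , leftChild-within)
          (λ i a → case-node-within (var-within 0F refl)
            (case-node-within (var-within 0F refl)
              (node-within (var-within 1F refl) (body⇓ i a))))
          (done-within leftChild-within))))
    (var-within 1F refl)

-- Drops the head of both lists in the state. On an index in unary and a list this is a step of
-- indexing; on two unary numbers it is a step of comparing them.
shorten : Exp (suc m)
shorten = case (var 0F) leaf (case (var 0F) leaf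
  (case (var 3F) leaf (node (var 3F) (var 1F))))

shorten-within : ∀ {ρ : Vec Tree m} {k l r s} →
  node (node k l) (node r s) ∷ ρ ⊢ shorten ⇓ node l s within 9
shorten-within = case-node-within (var-within 0F refl) (case-node-within (var-within 0F refl)
  (case-node-within (var-within 3F refl)
    (node-within (var-within 3F refl) (var-within 1F refl))))

select : Exp m → Exp m → Exp m
select i v =
  case (while leftChild shorten (node i v))
    leaf (case (var 1F) leaf (var 0F))

selectTime : ℕ → ℕ → ℕ → ℕ
selectTime X p q = 1 + (1 + (1 + p + q) + (X * 13 + 4)) + 3

encodeVector : (A → Tree) → Vector A n → Tree
encodeVector enc f = encodeVec enc (Vec.tabulate f)

loop-select : ∀ {ρ : Vec Tree m} (enc : A → Tree) (f : Vector A n) i {X} → toℕ i ≤ X →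
  ∃ λ r → ρ ⊢loop leftChild body shorten
    from node (unary (toℕ i)) (encodeVector enc f) ⇓ node leaf (node (enc (f i)) r)
    within X * 13 + 4
loop-select enc f zero _ =
  _ , weaken-loop (ℕ.m≤n+m 4 _) (done-within leftChild-within)
loop-select enc f (suc i) (s≤s i≤X) with loop-select enc (f ∘ suc) i i≤X
... | r , rest = r , step-within leftChild-within shorten-within rest

select-within : ∀ {ρ : Vec Tree m} {i v X p q} (enc : A → Tree) (f : Vector A n) j →
  n ≤ X →
  ρ ⊢ i ⇓ unary (toℕ j) within p → ρ ⊢ v ⇓ encodeVector enc f within q →
  ρ ⊢ select i v ⇓ enc (f j) within selectTime X p q
select-within enc f j n≤X i⇓ v⇓
  with loop-select enc f j (ℕ.≤-trans (ℕ.<⇒≤ (Finₚ.toℕ<n j)) n≤X)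
... | _ , l⇓ = case-node-within (while-within (node-within i⇓ v⇓) l⇓)
  (case-node-within (var-within 1F refl) (var-within 0F refl))

bothNodes : Exp (suc m)
bothNodes = case (var 0F) leaf (case (var 0F) leaf (var 3F))

less : Exp m → Exp m → Exp m
less i j =
  case (while bothNodes shorten (node i j)) leaf (case (var 1F) leaf (node leaf leaf))

lessTime : ℕ → ℕ → ℕ → ℕ
lessTime X p q = 1 + (1 + (1 + p + q) + (X * 15 + 6)) + 6

-- Both numbers lose 1 until one is exhausted, and then the second has something left exactly if it
-- was the larger. There are at most j iterations.
loop-less : ∀ {ρ : Vec Tree m} i j {X} → j ≤ X →
  ∃ λ t → ∃ λ k → (0 <ᵇ k) ≡ (i <ᵇ j) ×
  ρ ⊢loop bothNodes body shorten from node (unary i) (unary j) ⇓ node t (unary k)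
    within X * 15 + 6
loop-less zero j _ = _ , j , refl ,
  weaken-loop (ℕ.m≤n+m 6 _) (done-within (case-node-within (var-within 0F refl)
    (case-leaf-within (var-within 0F refl) leaf-within)))
loop-less (suc i) zero _ = _ , 0 , refl ,
  weaken-loop (ℕ.m≤n+m 6 _) (done-within (case-node-within (var-within 0F refl)
    (case-node-within (var-within 0F refl) (var-within 3F refl))))
loop-less (suc i) (suc j) (s≤s j≤X) with loop-less i j j≤X
... | t , k , k≡ , rest = t , k , k≡ , step-within
  (case-node-within (var-within 0F refl)
    (case-node-within (var-within 0F refl) (var-within 3F refl)))
  shorten-within rest

less-within : ∀ {ρ : Vec Tree m} {e e′ X p q} i j → j ≤ X →
  ρ ⊢ e ⇓ unary i within p → ρ ⊢ e′ ⇓ unary j within q →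
  ρ ⊢ less e e′ ⇓ encodeBool (i <ᵇ j) within lessTime X p q
less-within {ρ = ρ} i j j≤X i⇓ j⇓ with loop-less {ρ = ρ} i j j≤X
... | t , k , k≡ , l⇓ = case-node-within (while-within (node-within i⇓ j⇓) l⇓)
  (value-≡ (cong encodeBool k≡) (positive k))
  where
  positive : ∀ k → t ∷ unary k ∷ ρ ⊢ case (var 1F) leaf (node leaf leaf) ⇓
             encodeBool (0 <ᵇ k) within 6
  positive zero    = weaken (s≤s (s≤s (s≤s z≤n)))
    (case-leaf-within (var-within 1F refl) leaf-within)
  positive (suc k) = weaken (s≤s (s≤s (s≤s (s≤s (s≤s z≤n)))))
    (case-node-within (var-within 1F refl) (encodeBool-within true))

-- someSet s test: is test true for an element, bound to index 0, of the
-- list stored in the variable s?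
someSet : Fin m → Exp (5 + m) → Exp m
someSet s test =
  case (while leftChild
         (case (var 0F) leaf (case (var 0F) leaf
           (node (var 1F) (case test (var 3F) (node leaf leaf)))))
         (node (var s) leaf))
    leaf (var 1F)

someSetTime : ℕ → ℕ → ℕ
someSetTime X q = 1 + (1 + 3 + (X * (11 + q + 4) + 4)) + 1

module _ {ρ : Vec Tree m} (enc : A → Tree) (p : A → Bool) {test : Exp (5 + m)} {q}
  (test⇓ : ∀ x {a b c d} → enc x ∷ a ∷ b ∷ c ∷ d ∷ ρ ⊢ test ⇓ encodeBool (p x) within q)
  where

  loop-someSet : ∀ xs b {X} → length xs ≤ X →
    ρ ⊢loop leftChild
      body case (var 0F) leaf (case (var 0F) leaf
             (node (var 1F) (case test (var 3F) (node leaf leaf))))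
      from node (encodeList enc xs) (encodeBool b) ⇓ node leaf (encodeBool (any p xs ∨ b))
      within X * (11 + q + 4) + 4
  loop-someSet []       b _ = weaken-loop (ℕ.m≤n+m 4 _) (done-within leftChild-within)
  loop-someSet (x ∷ xs) b (s≤s {n = X} l≤X) =
    weaken-loop (ℕ.≤-reflexive (sym (ℕ.+-assoc (11 + q + 4) (X * (11 + q + 4)) 4)))
      (step-within leftChild-within
        (case-node-within (var-within 0F refl) (case-node-within (var-within 0F refl)
          (node-within (var-within 1F refl)
            (if-within (p x) (test⇓ x)
              (λ px≡ → var-within 3F (cong (λ c → encodeBool (c ∨ b)) (sym px≡)))
              (λ px≡ → value-≡ (cong (λ c → encodeBool (c ∨ b)) (sym px≡)) (encodeBool-within true))))))
        -- The loop absorbs elements into the accumulator from the front, whereas `any` keeps the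
        -- head outermost; commutativity reconciles the two.
        (loop-≡ (cong (node leaf ∘ encodeBool)
          (trans (sym (Bool.∨-assoc (any p xs) (p x) b))
                 (cong (_∨ b) (Bool.∨-comm (any p xs) (p x)))))
          (loop-someSet xs (p x ∨ b) l≤X)))

  someSet-within : ∀ {s X} xs → lookup ρ s ≡ encodeList enc xs → length xs ≤ X →
    ρ ⊢ someSet s test ⇓ encodeBool (any p xs) within someSetTime X q
  someSet-within {s} xs s≡ l≤X = case-node-within
    (while-within (node-within (var-within s s≡) leaf-within)
      (loop-someSet xs false l≤X))
    (var-within 1F (cong encodeBool (Bool.∨-identityʳ (any p xs))))

-- A typed language in which every loop runs over the universe or the sets,
-- so that polynomial running time is automatic

infixr 7 _⊗_

data Ty : Set where
  bool elt : Ty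
  vec list : Ty → Ty
  _⊗_      : Ty → Ty → Ty

⟪_⟫ : Ty → ℕ → Set
⟪ bool ⟫   n = Bool
⟪ elt ⟫    n = Fin n
⟪ vec τ ⟫  n = Vector (⟪ τ ⟫ n) n
⟪ list τ ⟫ n = List (⟪ τ ⟫ n)
⟪ σ ⊗ τ ⟫  n = ⟪ σ ⟫ n × ⟪ τ ⟫ n

encode : ∀ τ → ⟪ τ ⟫ n → Tree
encode bool     b       = encodeBool b
encode elt      i       = unary (toℕ i)
encode (vec τ)  f       = encodeVector (encode τ) f
encode (list τ) xs      = encodeList (encode τ) xs
encode (σ ⊗ τ)  (x , y) = node (encode σ x) (encode τ y)

infix 4 _∋_

data _∋_ : List Ty → Ty → Set where
  top  : ∀ {Γ τ} → τ ∷ Γ ∋ τ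
  pop : ∀ {Γ σ τ} → Γ ∋ τ → σ ∷ Γ ∋ τ

private
  variable
    Γ : List Ty
    σ τ : Ty

infix 10 _!_

data Tm (Γ : List Ty) : Ty → Set where
  var           : Γ ∋ τ → Tm Γ τ
  tt ff         : Tm Γ bool
  and           : Tm Γ bool → Tm Γ bool → Tm Γ bool
  neg           : Tm Γ bool → Tm Γ bool
  if            : Tm Γ bool → Tm Γ τ → Tm Γ τ → Tm Γ τ
  bind          : Tm Γ σ → Tm (σ ∷ Γ) τ → Tm Γ τ
  nil           : Tm Γ (list τ)
  cons          : Tm Γ τ → Tm Γ (list τ) → Tm Γ (list τ)
  pair          : Tm Γ σ → Tm Γ τ → Tm Γ (σ ⊗ τ)
  tab           : Tm (elt ∷ Γ) τ → Tm Γ (vec τ)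
  _!_           : Tm Γ (vec τ) → Tm Γ elt → Tm Γ τ
  lt            : Tm Γ elt → Tm Γ elt → Tm Γ bool
  some          : Tm (elt ∷ Γ) bool → Tm Γ bool
  someSetSuch   : Tm (vec bool ∷ Γ) bool → Tm Γ bool
  fold          : Tm (σ ∷ elt ∷ Γ) σ → Tm Γ σ → Tm Γ σ

Env : List Ty → ℕ → Set
Env Γ n = ∀ {τ} → Γ ∋ τ → ⟪ τ ⟫ n

infixr 5 _▸_

_▸_ : ⟪ σ ⟫ n → Env Γ n → Env (σ ∷ Γ) n
(a ▸ γ) top      = a
(a ▸ γ) (pop x) = γ x

anyFin : (Fin n → Bool) → Bool
anyFin p = foldFin (λ i b → p i ∨ b) false

infix 4 _<?ᵇ_

_<?ᵇ_ : Fin n → Fin n → Bool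
i <?ᵇ j = toℕ i <ᵇ toℕ j

module Semantics {n} (sets : List (Subset n)) where

  ⟦_⟧ : Tm Γ τ → Env Γ n → ⟪ τ ⟫ n
  ⟦ var x ⟧         γ = γ x
  ⟦ tt ⟧            γ = true
  ⟦ ff ⟧            γ = false
  ⟦ and a b ⟧       γ = ⟦ a ⟧ γ ∧ ⟦ b ⟧ γ
  ⟦ neg a ⟧         γ = not (⟦ a ⟧ γ)
  ⟦ if c a b ⟧      γ = if ⟦ c ⟧ γ then ⟦ a ⟧ γ else ⟦ b ⟧ γ
  ⟦ bind a b ⟧      γ = ⟦ b ⟧ (⟦ a ⟧ γ ▸ γ)
  ⟦ nil ⟧           γ = []
  ⟦ cons a b ⟧      γ = ⟦ a ⟧ γ ∷ ⟦ b ⟧ γ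
  ⟦ pair a b ⟧      γ = ⟦ a ⟧ γ , ⟦ b ⟧ γ
  ⟦ tab a ⟧         γ = λ i → ⟦ a ⟧ (i ▸ γ)
  ⟦ a ! i ⟧         γ = ⟦ a ⟧ γ (⟦ i ⟧ γ)
  ⟦ lt i j ⟧        γ = ⟦ i ⟧ γ <?ᵇ ⟦ j ⟧ γ
  ⟦ some a ⟧        γ = anyFin λ i → ⟦ a ⟧ (i ▸ γ)
  ⟦ someSetSuch a ⟧ γ = any (λ A → ⟦ a ⟧ (lookup A ▸ γ)) sets
  ⟦ fold b a ⟧      γ = foldFin (λ i x → ⟦ b ⟧ (x ▸ i ▸ γ)) (⟦ a ⟧ γ)

-- Where a compiled term finds its variables, the universe size in unary,
-- and the list of sets.
record Slots (Γ : List Ty) (m : ℕ) : Set where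
  field
    slot   : Γ ∋ τ → Fin m
    size   : Fin m
    system : Fin m

open Slots

shift : ∀ k → Slots Γ m → Slots Γ (k + m)
shift k s = record
  { slot = λ x → k ↑ʳ slot s x ; size = k ↑ʳ size s ; system = k ↑ʳ system s }

infixl 5 _◂_

_◂_ : Slots Γ m → Fin m → Slots (σ ∷ Γ) m
s ◂ i = record
  { slot = λ { top → i ; (pop x) → slot s x } ; size = size s ; system = system s }

compile : Tm Γ τ → Slots Γ m → Exp m
compile (var x)         s = var (slot s x)
compile tt              s = node leaf leaf
compile ff              s = leaf
compile (and a b)       s = case (compile a s) leaf (compile b (shift 2 s))
compile (neg a)         s = case (compile a s) (node leaf leaf) leaf
compile (if c a b)      s = case (compile c s) (compile b s) (compile a (shift 2 s))
compile (bind a b)      s = let′ (compile a s) (compile b (shift 1 s ◂ 0F))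
compile nil             s = leaf
compile (cons a b)      s = node (compile a s) (compile b s)
compile (pair a b)      s = node (compile a s) (compile b s)
compile (tab a)         s =
  countdown (size s) (node (compile a (shift 5 s ◂ 1F)) (var 3F)) leaf
compile (a ! i)         s = select (compile i s) (compile a s)
compile (lt i j)        s = less (compile i s) (compile j s)
compile (some a)        s =
  countdown (size s) (case (compile a (shift 5 s ◂ 1F)) (var 3F) (node leaf leaf)) leaf
compile (someSetSuch a) s = someSet (system s) (compile a (shift 5 s ◂ 0F))
compile (fold b a)      s =
  countdown (size s) (compile b (shift 5 s ◂ 1F ◂ 3F)) (compile a s)

-- `X` bounds both the universe size and the number of sets. Values of variables do not enter, so a
-- fixed term has a polynomial bound by structural recursion.
time : Tm Γ τ → ℕ → ℕ
time (var x)         X = 1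
time tt              X = 3
time ff              X = 1
time (and a b)       X = 1 + time a X + (1 + time b X)
time (neg a)         X = 1 + time a X + 4
time (if c a b)      X = 1 + time c X + (time b X + time a X)
time (bind a b)      X = 1 + time a X + time b X
time nil             X = 1
time (cons a b)      X = 1 + time a X + time b X
time (pair a b)      X = 1 + time a X + time b X
time (tab a)         X = countdownTime X 1 (1 + time a X + 1)
time (a ! i)         X = selectTime X (time i X) (time a X)
time (lt i j)        X = lessTime X (time i X) (time j X)
time (some a)        X = countdownTime X 1 (1 + time a X + 4)
time (someSetSuch a) X = someSetTime X (time a X)
time (fold b a)      X = countdownTime X (time a X) (time b X)

foldFin-tabulate : ∀ {n} (f : Fin n → A) →
                   foldFin (λ i xs → f i ∷ xs) [] ≡ Vec.toList (Vec.tabulate f)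
foldFin-tabulate {n = zero}  f = refl
foldFin-tabulate {n = suc n} f = cong (f zero ∷_) (foldFin-tabulate (f ∘ suc))

module Compilation {n} (sets : List (Subset n)) {X} (n≤X : n ≤ X) (l≤X : length sets ≤ X) where

  open Semantics sets

  record Agree (ρ : Vec Tree m) (s : Slots Γ m) (γ : Env Γ n) : Set where
    field
      slot-≡   : (x : Γ ∋ τ) → lookup ρ (slot s x) ≡ encode τ (γ x)
      size-≡   : lookup ρ (size s) ≡ unary n
      system-≡ : lookup ρ (system s) ≡ encodeList (encodeVec encodeBool) sets

  open Agree

  private
    variable
      ρ : Vec Tree m
      s : Slots Γ m
      γ : Env Γ n

  shift₁ : ∀ {a} → Agree ρ s γ → Agree (a ∷ ρ) (shift 1 s) γ
  shift₁ h = record { slot-≡ = slot-≡ h ; size-≡ = size-≡ h ; system-≡ = system-≡ h }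

  shift₂ : ∀ {a b} → Agree ρ s γ → Agree (a ∷ b ∷ ρ) (shift 2 s) γ
  shift₂ h = record { slot-≡ = slot-≡ h ; size-≡ = size-≡ h ; system-≡ = system-≡ h }

  shift₅ : ∀ {a b c d e} → Agree ρ s γ → Agree (a ∷ b ∷ c ∷ d ∷ e ∷ ρ) (shift 5 s) γ
  shift₅ h = record { slot-≡ = slot-≡ h ; size-≡ = size-≡ h ; system-≡ = system-≡ h }

  extend : ∀ {i} {a : ⟪ σ ⟫ n} → Agree ρ s γ → lookup ρ i ≡ encode σ a →
           Agree ρ (s ◂ i) (a ▸ γ)
  extend h i≡ = record
    { slot-≡ = λ { top → i≡ ; (pop x) → slot-≡ h x }
    ; size-≡ = size-≡ h ; system-≡ = system-≡ h }

  compile-within : (t : Tm Γ τ) → Agree ρ s γ →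
                   ρ ⊢ compile t s ⇓ encode τ (⟦ t ⟧ γ) within time t X
  compile-within (var x) h = var-within _ (slot-≡ h x)
  compile-within tt h = encodeBool-within true
  compile-within ff h = leaf-within
  compile-within {γ = γ} (and a b) h = if-within (⟦ a ⟧ γ) (compile-within a h)
    (λ a≡ → value-≡ (cong (λ c → encodeBool (c ∧ ⟦ b ⟧ γ)) (sym a≡)) leaf-within)
    (λ a≡ → value-≡ (cong (λ c → encodeBool (c ∧ ⟦ b ⟧ γ)) (sym a≡))
              (compile-within b (shift₂ h)))
  compile-within {γ = γ} (neg a) h = if-within (⟦ a ⟧ γ) (compile-within a h)
    (λ a≡ → value-≡ (cong (encodeBool ∘ not) (sym a≡)) (encodeBool-within true))
    (λ a≡ → value-≡ (cong (encodeBool ∘ not) (sym a≡)) leaf-within)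
  compile-within {τ = τ} {γ = γ} (if c a b) h = if-within (⟦ c ⟧ γ) (compile-within c h)
    (λ c≡ → value-≡ (cong (λ x → encode τ (if x then ⟦ a ⟧ γ else ⟦ b ⟧ γ)) (sym c≡))
              (compile-within b h))
    (λ c≡ → value-≡ (cong (λ x → encode τ (if x then ⟦ a ⟧ γ else ⟦ b ⟧ γ)) (sym c≡))
              (compile-within a (shift₂ h)))
  compile-within (bind a b) h =
    let-within (compile-within a h) (compile-within b (extend (shift₁ h) refl))
  compile-within nil h = leaf-within
  compile-within (cons a b) h = node-within (compile-within a h) (compile-within b h)
  compile-within (pair a b) h = node-within (compile-within a h) (compile-within b h)
  compile-within {τ = vec τ} (tab a) h =
    value-≡ (cong (encodeList (encode τ)) (foldFin-tabulate _))
      (countdown-within (encodeList (encode τ)) _ (size-≡ h) n≤X leaf-within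
        (λ i xs → node-within (compile-within a (extend (shift₅ h) refl))
                              (var-within 3F refl)))
  compile-within {τ = τ} {γ = γ} (a ! i) h =
    select-within (encode τ) (⟦ a ⟧ γ) (⟦ i ⟧ γ) n≤X (compile-within i h) (compile-within a h)
  compile-within {γ = γ} (lt i j) h =
    less-within (toℕ (⟦ i ⟧ γ)) (toℕ (⟦ j ⟧ γ)) (ℕ.≤-trans (ℕ.<⇒≤ (Finₚ.toℕ<n _)) n≤X)
      (compile-within i h) (compile-within j h)
  compile-within {γ = γ} (some a) h =
    countdown-within encodeBool _ (size-≡ h) n≤X leaf-within
      (λ i b → if-within (⟦ a ⟧ (i ▸ γ)) (compile-within a (extend (shift₅ h) refl))
        (λ a≡ → var-within 3F (cong (λ c → encodeBool (c ∨ b)) (sym a≡)))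
        (λ a≡ → value-≡ (cong (λ c → encodeBool (c ∨ b)) (sym a≡)) (encodeBool-within true)))
  compile-within (someSetSuch a) h =
    someSet-within (encodeVec encodeBool) _
      -- Terms see a set as a function, while the input stores its incidence vector; tabulating the
      -- function gives back the same tree.
      (λ A → compile-within a (extend (shift₅ h)
        (cong (encodeVec encodeBool) (sym (Vec.tabulate∘lookup A)))))
      sets (system-≡ h) l≤X
  compile-within {τ = τ} (fold b a) h =
    countdown-within (encode τ) _ (size-≡ h) n≤X (compile-within a h)
      (λ i x → compile-within b (extend (extend (shift₅ h) refl) refl))

-- Polynomial bounds

-- From 2 onwards a bare power suffices: a constant c is at most 2^c, and the factor 2 that arises
-- from a sum costs one more power.
Polynomial : (ℕ → ℕ) → Set
Polynomial f = ∃ λ e → ∀ {X} → 2 ≤ X → f X ≤ X ^ e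

module _ where

  private
    variable
      f g : ℕ → ℕ

    ^-mono : ∀ {X a b} → 2 ≤ X → a ≤ b → X ^ a ≤ X ^ b
    ^-mono {X} (s≤s _) a≤b = ℕ.^-monoʳ-≤ X a≤b

  n≤2^n : ∀ n → n ≤ 2 ^ n
  n≤2^n zero    = z≤n
  n≤2^n (suc n) = begin
    suc n            ≤⟨ ℕ.+-mono-≤ (ℕ.m^n>0 2 n) (n≤2^n n) ⟩
    2 ^ n + 2 ^ n    ≡⟨ cong (λ k → 2 ^ n + k) (ℕ.+-identityʳ _) ⟨
    2 ^ suc n        ∎
    where open ℕ.≤-Reasoning

  const-poly : ∀ c → Polynomial (λ _ → c)
  const-poly c = c , λ 2≤X → ℕ.≤-trans (n≤2^n c) (ℕ.^-monoˡ-≤ c 2≤X)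

  id-poly : Polynomial id
  id-poly = 1 , λ _ → ℕ.≤-reflexive (sym (ℕ.^-identityʳ _))

  *-poly : Polynomial f → Polynomial g → Polynomial (λ X → f X * g X)
  *-poly (d , f≤) (e , g≤) = d + e , λ {X} 2≤X →
    ℕ.≤-trans (ℕ.*-mono-≤ (f≤ 2≤X) (g≤ 2≤X)) (ℕ.≤-reflexive (sym (ℕ.^-distribˡ-+-* X d e)))

  +-poly : Polynomial f → Polynomial g → Polynomial (λ X → f X + g X)
  +-poly {f} {g} (d , f≤) (e , g≤) = 1 + (d + e) , λ {X} 2≤X → begin
    f X + g X                    ≤⟨ ℕ.+-mono-≤ (f≤ 2≤X) (g≤ 2≤X) ⟩
    X ^ d + X ^ e                ≤⟨ ℕ.+-mono-≤ (^-mono 2≤X (ℕ.m≤m+n d e)) (^-mono 2≤X (ℕ.m≤n+m e d)) ⟩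
    X ^ (d + e) + X ^ (d + e)    ≡⟨ cong (λ k → X ^ (d + e) + k) (ℕ.+-identityʳ _) ⟨
    2 * X ^ (d + e)              ≤⟨ ℕ.*-monoˡ-≤ (X ^ (d + e)) 2≤X ⟩
    X ^ (1 + (d + e))            ∎
    where open ℕ.≤-Reasoning

  countdown-poly : Polynomial f → Polynomial g →
                   Polynomial (λ X → countdownTime X (f X) (g X))
  countdown-poly p q =
    +-poly (+-poly (const-poly 1) (+-poly (+-poly (const-poly 1) (+-poly (const-poly 2) p))
      (+-poly (*-poly id-poly (+-poly (const-poly 10) q)) (const-poly 4)))) (const-poly 1)

  time-poly : (t : Tm Γ τ) → Polynomial (time t)
  time-poly (var x)         = const-poly 1
  time-poly tt              = const-poly 3
  time-poly ff              = const-poly 1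
  time-poly (and a b)       =
    +-poly (+-poly (const-poly 1) (time-poly a)) (+-poly (const-poly 1) (time-poly b))
  time-poly (neg a)         = +-poly (+-poly (const-poly 1) (time-poly a)) (const-poly 4)
  time-poly (if c a b)      =
    +-poly (+-poly (const-poly 1) (time-poly c)) (+-poly (time-poly b) (time-poly a))
  time-poly (bind a b)      = +-poly (+-poly (const-poly 1) (time-poly a)) (time-poly b)
  time-poly nil             = const-poly 1
  time-poly (cons a b)      = +-poly (+-poly (const-poly 1) (time-poly a)) (time-poly b)
  time-poly (pair a b)      = +-poly (+-poly (const-poly 1) (time-poly a)) (time-poly b)
  time-poly (tab a)         = countdown-poly (const-poly 1)
    (+-poly (+-poly (const-poly 1) (time-poly a)) (const-poly 1))
  time-poly (a ! i)         =
    +-poly (+-poly (const-poly 1) (+-poly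
      (+-poly (const-poly 1) (+-poly (+-poly (const-poly 1) (time-poly i)) (time-poly a)))
      (+-poly (*-poly id-poly (const-poly 13)) (const-poly 4)))) (const-poly 3)
  time-poly (lt i j)        =
    +-poly (+-poly (const-poly 1) (+-poly
      (+-poly (const-poly 1) (+-poly (+-poly (const-poly 1) (time-poly i)) (time-poly j)))
      (+-poly (*-poly id-poly (const-poly 15)) (const-poly 6)))) (const-poly 6)
  time-poly (some a)        = countdown-poly (const-poly 1)
    (+-poly (+-poly (const-poly 1) (time-poly a)) (const-poly 4))
  time-poly (someSetSuch a) =
    +-poly (+-poly (const-poly 1) (+-poly (const-poly 4)
      (+-poly (*-poly id-poly (+-poly (+-poly (const-poly 11) (time-poly a)) (const-poly 4)))
              (const-poly 4)))) (const-poly 1)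
  time-poly (fold b a)      = countdown-poly (time-poly a) (time-poly b)

-- The algorithm

eqT : Tm Γ elt → Tm Γ elt → Tm Γ bool
eqT i j = and (neg (lt i j)) (neg (lt j i))

coT : Γ ∋ elt → Γ ∋ elt → Tm Γ bool
coT u v = someSetSuch (and (var top ! var (pop u)) (var top ! var (pop v)))

commonT : Γ ∋ elt → Γ ∋ elt → Γ ∋ elt → Tm Γ bool
commonT u v w = someSetSuch (and (var top ! var (pop u))
  (and (var top ! var (pop v)) (var top ! var (pop w))))

nearT : Γ ∋ elt → Γ ∋ elt → Tm Γ bool
nearT u v = some (and (coT (pop u) top) (coT top (pop v)))

clashT : Γ ∋ vec elt → Γ ∋ elt → Γ ∋ elt → Tm Γ bool
clashT col v i = some (and (lt (var (pop v)) (var top))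
  (and (eqT (var (pop col) ! var top) (var (pop i))) (nearT top (pop v))))

pickT : Γ ∋ vec elt → Γ ∋ elt → Tm Γ elt
pickT col v = fold
  (if (clashT (pop (pop col)) (pop (pop v)) (pop top))
      (var top) (var (pop top)))
  (var v)

colouringT : Tm Γ (vec elt)
colouringT = fold
  (bind (pickT top (pop top))
    (tab (if (eqT (var top) (var (pop (pop (pop top)))))
             (var (pop top))
             (var (pop (pop top)) ! var top))))
  (tab (var top))

codeT : Bool → Γ ∋ elt → Γ ∋ elt → Tm Γ bool
codeT true  u p = eqT (var p) (var u)
codeT false u p = neg (eqT (var p) (var u))

module _ (col : Γ ∋ vec elt) (v : Γ ∋ elt) where

  bitT : Bool → (a b p : Γ ∋ elt) → Tm Γ bool
  bitT s a b p =
    if (eqT (var col ! var v) (var b))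
       (neg (some (and (eqT (var (pop col) ! var top) (var (pop a)))
         (and (neg (eqT (var top) (var (pop v))))
           (and (coT top (pop v)) (codeT s top (pop p)))))))
       (and (eqT (var col ! var v) (var a)) (codeT s v p))

  badT : (a b c : Γ ∋ elt) → Tm Γ bool
  badT a b c = some (some (some
    (and (eqT (var (up col) ! var x) (var (up a)))
    (and (eqT (var (up col) ! var y) (var (up b)))
    (and (eqT (var (up col) ! var z) (var (up c)))
    (and (coT x y) (and (coT y z) (and (coT x z)
    (and (neg (commonT x y z))
         (neg (and (neg (eqT (var (up v)) (var x)))
              (and (neg (eqT (var (up v)) (var y)))
                   (neg (eqT (var (up v)) (var z)))))))))))))))
    where
    up : Γ ∋ τ → elt ∷ elt ∷ elt ∷ Γ ∋ τ
    up = pop ∘ pop ∘ pop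
    x y z : elt ∷ elt ∷ elt ∷ Γ ∋ elt
    x = pop (pop top)
    y = pop top
    z = top

fractionTy : Ty
fractionTy = list bool ⊗ list bool

onesT : Tm Γ (list bool)
onesT = fold (cons tt (var top)) nil

pairEntryT : Γ ∋ vec elt → Γ ∋ elt → Bool → (a b : Γ ∋ elt) → Tm Γ fractionTy
pairEntryT {Γ} col v s a b =
  pair (fold (cons (bitT (up col) (up v) s (up a) (up b) (pop top)) (var top)) nil) onesT
  where
  up : Γ ∋ τ → list bool ∷ elt ∷ Γ ∋ τ
  up = pop ∘ pop

tripleEntryT : Γ ∋ vec elt → Γ ∋ elt → (a b c : Γ ∋ elt) → Tm Γ fractionTy
tripleEntryT col v a b c = pair (cons (badT col v a b c) nil) (cons ff (cons tt nil))

usedT : Γ ∋ vec elt → Γ ∋ elt → Tm Γ bool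
usedT col a = some (eqT (var (pop col) ! var top) (var (pop a)))

rowT : Γ ∋ vec elt → Γ ∋ elt → Tm Γ (list fractionTy)
rowT {Γ} col v = fold (fold (fold
  (if (and (usedT (up col) a) (and (usedT (up col) b) (usedT (up col) c)))
      (cons (pairEntryT (up col) (up v) true a b)
      (cons (pairEntryT (up col) (up v) false a b)
      (cons (tripleEntryT (up col) (up v) a b c)
      (var top))))
      (var top))
  (var top)) (var top)) nil
  where
  Γ′ : List Ty
  Γ′ = list fractionTy ∷ elt ∷ list fractionTy ∷ elt ∷ list fractionTy ∷ elt ∷ Γ
  up : Γ ∋ τ → Γ′ ∋ τ
  up = pop ∘ pop ∘ pop ∘ pop ∘ pop ∘ pop
  a b c : Γ′ ∋ elt
  a = pop (pop (pop (pop (pop top))))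
  b = pop (pop (pop top))
  c = pop top

matrixT : Tm [] (vec (list fractionTy))
matrixT = bind colouringT (tab (rowT (pop top) top))

infix 4 _≡ᵇ_

_≡ᵇ_ : Fin n → Fin n → Bool
i ≡ᵇ j = not (i <?ᵇ j) ∧ not (j <?ᵇ i)

bits : ∀ {n} → (Fin n → Bool) → List Bool
bits f = foldFin (λ p xs → f p ∷ xs) []

-- The binary digits of 2^u, and for `false` those of D - 2^u.
code : Bool → Fin n → Fin n → Bool
code true  u p = p ≡ᵇ u
code false u p = not (p ≡ᵇ u)

data Coordinate (n : ℕ) : Set where
  pairs   : Bool → (a b : Fin n) → Coordinate n
  triples : (a b c : Fin n) → Coordinate n

Fraction : Set
Fraction = List Bool × List Bool

module Algorithm {n} (sets : List (Subset n)) where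

  co : Fin n → Fin n → Bool
  co u v = any (λ A → lookup A u ∧ lookup A v) sets

  common : Fin n → Fin n → Fin n → Bool
  common u v w = any (λ A → lookup A u ∧ (lookup A v ∧ lookup A w)) sets

  near : Fin n → Fin n → Bool
  near u v = anyFin λ w → co u w ∧ co w v

  clash : (Fin n → Fin n) → Fin n → Fin n → Bool
  clash col v i = anyFin λ u → (v <?ᵇ u) ∧ ((col u ≡ᵇ i) ∧ near u v)

  -- The default v is never returned: fewer than n elements are above v.
  pick : (Fin n → Fin n) → Fin n → Fin n
  pick col v = foldFin (λ i j → if clash col v i then j else i) v

  recolour : Fin n → (Fin n → Fin n) → Fin n → Fin n
  recolour v col u = if u ≡ᵇ v then pick col v else col u

  -- foldFin treats the last element first; at the turn of v, precisely the
  -- elements above v hold their final colours.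
  colouring : Fin n → Fin n
  colouring = foldFin recolour id

  module Coordinates (col : Fin n → Fin n) where

    -- Colour b is tested first, so that for a = b the elements of that colour get only digits 1: in
    -- a proper colouring none of them shares a set with another. For a ≠ b the disjunction has at
    -- most one candidate, the partner of v, and its negation is the digit of D minus the partner's
    -- number.
    bit : Bool → (a b v p : Fin n) → Bool
    bit s a b v p = if col v ≡ᵇ b
      then not (anyFin λ u → (col u ≡ᵇ a) ∧ (not (u ≡ᵇ v) ∧ (co u v ∧ code s u p)))
      else (col v ≡ᵇ a) ∧ code s v p

    bad : (a b c v : Fin n) → Bool
    bad a b c v = anyFin λ x → anyFin λ y → anyFin λ z →
      (col x ≡ᵇ a) ∧ ((col y ≡ᵇ b) ∧ ((col z ≡ᵇ c) ∧
      (co x y ∧ (co y z ∧ (co x z ∧ (not (common x y z) ∧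
      not (not (v ≡ᵇ x) ∧ (not (v ≡ᵇ y) ∧ not (v ≡ᵇ z)))))))))

    used : Fin n → Bool
    used a = anyFin λ u → col u ≡ᵇ a

    entry : Fin n → Coordinate n → Fraction
    entry v (pairs s a b)   = bits (bit s a b v) , bits {n} (λ _ → true)
    -- The denominator is 2, least significant digit first, and the numerator is 0 or 1.
    entry v (triples a b c) = bad a b c v ∷ [] , false ∷ true ∷ []

    -- Applied to the identity this lists the coordinates, applied to `entry v` it gives the row of
    -- v. A pair coordinate recurs for every used colour c, which the cubic count absorbs.
    forUsed : ∀ {A : Set} → (Coordinate n → A) → List A
    forUsed f =
      foldFin (λ a → foldFin λ b → foldFin λ c xs →
        if used a ∧ (used b ∧ used c)
        then f (pairs true a b) ∷ f (pairs false a b) ∷ f (triples a b c) ∷ xs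
        else xs) []

-- Boolean tests, folds and counting

∧⁺ : ∀ {a b} → T a → T b → T (a ∧ b)
∧⁺ ta tb = Equivalence.from Bool.T-∧ (ta , tb)

∧⁻ : ∀ {a b} → T (a ∧ b) → T a × T b
∧⁻ = Equivalence.to Bool.T-∧

not⁺ : ∀ {b} → ¬ T b → T (not b)
not⁺ {false} _ = _
not⁺ {true}  h = h _

not⁻ : ∀ {b} → T (not b) → ¬ T b
not⁻ {false} _ ()

anyFin⁺ : (p : Fin n → Bool) → ∃ (T ∘ p) → T (anyFin p)
anyFin⁺ p (zero  , h) = Equivalence.from Bool.T-∨ (inj₁ h)
anyFin⁺ p (suc i , h) = Equivalence.from (Bool.T-∨ {p zero}) (inj₂ (anyFin⁺ (p ∘ suc) (i , h)))

anyFin⁻ : ∀ {n} (p : Fin n → Bool) → T (anyFin p) → ∃ (T ∘ p)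
anyFin⁻ {suc n} p h with Equivalence.to (Bool.T-∨ {p zero}) h
... | inj₁ h₀ = zero , h₀
... | inj₂ hₛ with anyFin⁻ (p ∘ suc) hₛ
...   | i , hᵢ = suc i , hᵢ

≡ᵇ⇒≡ : {i j : Fin n} → T (i ≡ᵇ j) → i ≡ j
≡ᵇ⇒≡ {i = i} {j} h with ∧⁻ {not (i <?ᵇ j)} h
... | i≮j , j≮i = Finₚ.toℕ-injective (ℕ.≤-antisym
  (ℕ.≮⇒≥ (not⁻ j≮i ∘ ℕ.<⇒<ᵇ)) (ℕ.≮⇒≥ (not⁻ i≮j ∘ ℕ.<⇒<ᵇ)))

≡⇒≡ᵇ : {i j : Fin n} → i ≡ j → T (i ≡ᵇ j)
≡⇒≡ᵇ {i = i} refl = ∧⁺ i≮i i≮i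
  where
  i≮i : T (not (i <?ᵇ i))
  i≮i = not⁺ (ℕ.<-irrefl refl ∘ ℕ.<ᵇ⇒< (toℕ i) (toℕ i))

if-T : ∀ {b} {x y : A} → T b → (if b then x else y) ≡ x
if-T {b = true} _ = refl

if-¬T : ∀ {b} {x y : A} → ¬ T b → (if b then x else y) ≡ y
if-¬T {b = false} _ = refl
if-¬T {b = true}  h = ⊥-elim (h _)

∈⇒lookup : {A : Subset n} {v : Fin n} → v ∈ A → T (lookup A v)
∈⇒lookup v∈A = Equivalence.from Bool.T-≡ (Vec.[]=⇒lookup v∈A)

lookup⇒∈ : {A : Subset n} {v : Fin n} → T (lookup A v) → v ∈ A
lookup⇒∈ {A = A} {v} h = Vec.lookup⇒[]= v A (Equivalence.to Bool.T-≡ h)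

-- `P j` describes the state once the indices from j upwards have been treated.
foldFin-invariant : (P : ℕ → A → Set) (g : Fin n → A → A) →
  (∀ i a → P (suc (toℕ i)) a → P (toℕ i) (g i a)) → ∀ a → P n a → P 0 (foldFin g a)
foldFin-invariant {n = zero}  P g next a h = h
foldFin-invariant {n = suc n} P g next a h =
  next zero _ (foldFin-invariant (P ∘ suc) (g ∘ suc) (next ∘ suc) a h)

-- Index 0 is outermost, so the first index that fails the test overrides all later ones.
foldFin-first : (p : Fin n → Bool) (f : Fin n → A) (a : A) → (∃ λ i → ¬ T (p i)) →
  ∃ λ i → foldFin (λ i x → if p i then x else f i) a ≡ f i ×
          ¬ T (p i) × (∀ j → j Fin.< i → T (p j))
foldFin-first {n = suc n} p f a (i , ¬pi) with Bool.T? (p zero)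
... | no ¬p0 = zero , if-¬T ¬p0 , ¬p0 , λ _ ()
... | yes p0 with foldFin-first (p ∘ suc) (f ∘ suc) a (later i ¬pi)
  where
  later : ∀ i → ¬ T (p i) → ∃ λ j → ¬ T (p (suc j))
  later zero    ¬pi = ⊥-elim (¬pi p0)
  later (suc j) ¬pi = j , ¬pi
...   | k , eq , ¬pk , below = suc k , trans (if-T p0) eq , ¬pk ,
  λ { zero _ → p0 ; (suc j) (s≤s j<k) → below j j<k }

index-injective : ∀ {m} {xs : List A} (f : Fin m → A) → (∀ {i j} → f i ≡ f j → i ≡ j) →
                  (∀ i → f i ∈ˡ xs) → m ≤ length xs
index-injective {xs = xs} f f-inj f∈ = Finₚ.injective⇒≤ λ {i} {j} eq →
  f-inj (trans (Any.lookup-index (f∈ i))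
          (trans (cong (List.lookup xs) eq) (sym (Any.lookup-index (f∈ j)))))

length-concatMap≤ : ∀ (f : A → List B) {b} xs → (∀ {x} → x ∈ˡ xs → length (f x) ≤ b) →
                    length (concatMap f xs) ≤ length xs * b
length-concatMap≤ f []       f≤b = z≤n
length-concatMap≤ f {b} (x ∷ xs) f≤b = begin
  length (f x List.++ concatMap f xs)           ≡⟨ List.length-++ (f x) ⟩
  length (f x) + length (concatMap f xs)        ≤⟨ ℕ.+-mono-≤ (f≤b (here refl))
                                                     (length-concatMap≤ f xs (f≤b ∘ there)) ⟩
  b + length xs * b                             ∎
  where open ℕ.≤-Reasoning

Unique-lookup : {xs : List A} → Unique xs → ∀ {i j} →
                List.lookup xs i ≡ List.lookup xs j → i ≡ j
Unique-lookup (_ ∷ _)     {zero}  {zero}  _  = refl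
Unique-lookup (x∉ ∷ _)    {zero}  {suc j} eq =
  ⊥-elim (All.lookup x∉ (Membership.∈-lookup j) eq)
Unique-lookup (x∉ ∷ _)    {suc i} {zero}  eq =
  ⊥-elim (All.lookup x∉ (Membership.∈-lookup i) (sym eq))
Unique-lookup (_ ∷ uniq)  {suc i} {suc j} eq = cong suc (Unique-lookup uniq eq)

elements : Subset n → List (Fin n)
elements []          = []
elements (true  ∷ A) = zero ∷ map suc (elements A)
elements (false ∷ A) = map suc (elements A)

length-elements : (A : Subset n) → length (elements A) ≡ ∣ A ∣
length-elements []          = refl
length-elements (true  ∷ A) =
  cong suc (trans (List.length-map suc (elements A)) (length-elements A))
length-elements (false ∷ A) = trans (List.length-map suc (elements A)) (length-elements A)

∈-elements⁺ : {A : Subset n} {v : Fin n} → v ∈ A → v ∈ˡ elements A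
∈-elements⁺ {A = true  ∷ A} here        = here refl
∈-elements⁺ {A = true  ∷ A} (there v∈A) = there (Membership.∈-map⁺ suc (∈-elements⁺ v∈A))
∈-elements⁺ {A = false ∷ A} (there v∈A) = Membership.∈-map⁺ suc (∈-elements⁺ v∈A)

∈-elements⁻ : (A : Subset n) {v : Fin n} → v ∈ˡ elements A → v ∈ A
∈-elements⁻ (true  ∷ A) (here refl) = here
∈-elements⁻ (true  ∷ A) (there h) with Membership.∈-map⁻ suc h
... | _ , h′ , refl = there (∈-elements⁻ A h′)
∈-elements⁻ (false ∷ A) h with Membership.∈-map⁻ suc h
... | _ , h′ , refl = there (∈-elements⁻ A h′)

elements-unique : (A : Subset n) → Unique (elements A)
elements-unique []          = []
elements-unique (true  ∷ A) =
  All.map⁺ (All.tabulate λ _ ()) ∷ Unique.map⁺ Finₚ.suc-injective (elements-unique A)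
elements-unique (false ∷ A) = Unique.map⁺ Finₚ.suc-injective (elements-unique A)

elements-injective : (A B : Subset n) → elements A ≡ elements B → A ≡ B
elements-injective A B eq = Subset.⊆-antisym
  (λ v∈A → ∈-elements⁻ B (subst (_ ∈ˡ_) eq (∈-elements⁺ v∈A)))
  (λ v∈B → ∈-elements⁻ A (subst (_ ∈ˡ_) (sym eq) (∈-elements⁺ v∈B)))

two-elements : {A : Subset n} {x y : Fin n} → x ∈ A → y ∈ A → x ≢ y → 2 ≤ ∣ A ∣
two-elements {A = A} {x} {y} x∈A y∈A x≢y = ℕ.≤-trans
  (s≤s (ℕ.≤-<-trans z≤n (Subset.x∈p⇒∣p-x∣<∣p∣
    (Subset.x∈p∧x≢y⇒x∈p-y y∈A (x≢y ∘ sym)))))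
  (Subset.x∈p⇒∣p-x∣<∣p∣ x∈A)

-- A set of a simple system is determined by its first two elements.
module _ (𝒮 : SetSystem n) (simple : Simple 𝒮) where

  simple-≡ : ∀ {A B x y} → A ∈ˡ sets 𝒮 → B ∈ˡ sets 𝒮 → x ≢ y →
             x ∈ A → y ∈ A → x ∈ B → y ∈ B → A ≡ B
  simple-≡ {A} {B} A∈ B∈ x≢y x∈A y∈A x∈B y∈B with Vec.≡-dec Bool._≟_ A B
  ... | yes A≡B = A≡B
  ... | no  A≢B = contradiction
    (two-elements (Subset.x∈p∩q⁺ (x∈A , x∈B)) (Subset.x∈p∩q⁺ (y∈A , y∈B)) x≢y)
    (ℕ.<⇒≱ (s≤s (simple A∈ B∈ A≢B)))

  private
    -- `zero` stands for a missing element, so that sets with fewer than two elements have codes as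
    -- well.
    first : List (Fin n) → Fin (suc n)
    first []      = zero
    first (x ∷ _) = suc x

    firstTwo : Subset n → Fin (suc n * suc n)
    firstTwo A = Fin.combine (first (elements A)) (first (List.drop 1 (elements A)))

    firstTwo-injective : ∀ {A B} → A ∈ˡ sets 𝒮 → B ∈ˡ sets 𝒮 → firstTwo A ≡ firstTwo B → A ≡ B
    firstTwo-injective {A} {B} A∈ B∈ eq
      with Finₚ.combine-injective (first (elements A)) _ (first (elements B)) _ eq
    ... | eq₁ , eq₂ = cases (elements A) refl (elements B) refl eq₁ eq₂
      where
      cases : ∀ as → as ≡ elements A → ∀ bs → bs ≡ elements B → first as ≡ first bs →
              first (List.drop 1 as) ≡ first (List.drop 1 bs) → A ≡ B
      cases [] as≡ [] bs≡ _ _ = elements-injective A B (trans (sym as≡) bs≡)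
      cases (a ∷ []) as≡ (.a ∷ []) bs≡ refl _ =
        elements-injective A B (trans (sym as≡) bs≡)
      cases (x ∷ y ∷ as) as≡ (.x ∷ .y ∷ bs) bs≡ refl refl
        with subst Unique (sym as≡) (elements-unique A)
      ... | (x≢y ∷ _) ∷ _ = simple-≡ A∈ B∈ x≢y
        (mem A as≡ (here refl)) (mem A as≡ (there (here refl)))
        (mem B bs≡ (here refl)) (mem B bs≡ (there (here refl)))
        where
        mem : ∀ C {cs z} → cs ≡ elements C → z ∈ˡ cs → z ∈ C
        mem C refl = ∈-elements⁻ C

  -- Turns a time bound in n and the number of sets into one in n alone.
  number-of-sets : length (sets 𝒮) ≤ suc n * suc n
  number-of-sets = Finₚ.injective⇒≤ λ {i} {j} eq → Unique-lookup (distinct 𝒮)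
    (firstTwo-injective (Membership.∈-lookup i) (Membership.∈-lookup j) eq)

-- The greedy colouring

module Greedy {n} (sets : List (Subset n)) where

  open Algorithm sets public

  Co : Fin n → Fin n → Set
  Co u v = ∃ λ A → A ∈ˡ sets × u ∈ A × v ∈ A

  co⁺ : ∀ {u v} → Co u v → T (co u v)
  co⁺ (A , A∈ , u∈A , v∈A) = Any.any⁺ _ (lose A∈ (∧⁺ (∈⇒lookup u∈A) (∈⇒lookup v∈A)))

  co⁻ : ∀ {u v} → T (co u v) → Co u v
  co⁻ h with find (Any.any⁻ _ sets h)
  ... | A , A∈ , h′ with ∧⁻ h′
  ...   | u∈A , v∈A = A , A∈ , lookup⇒∈ u∈A , lookup⇒∈ v∈A

  Co-sym : ∀ {u v} → Co u v → Co v u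
  Co-sym (A , A∈ , u∈A , v∈A) = A , A∈ , v∈A , u∈A

  Common : Fin n → Fin n → Fin n → Set
  Common u v w = ∃ λ A → A ∈ˡ sets × u ∈ A × v ∈ A × w ∈ A

  common⁺ : ∀ {u v w} → Common u v w → T (common u v w)
  common⁺ (A , A∈ , u∈A , v∈A , w∈A) = Any.any⁺ _
    (lose A∈ (∧⁺ (∈⇒lookup u∈A) (∧⁺ (∈⇒lookup v∈A) (∈⇒lookup w∈A))))

  common⁻ : ∀ {u v w} → T (common u v w) → Common u v w
  common⁻ {u} h with find (Any.any⁻ _ sets h)
  ... | A , A∈ , h′ with ∧⁻ {lookup A u} h′
  ...   | u∈A , h″ with ∧⁻ h″
  ...     | v∈A , w∈A = A , A∈ , lookup⇒∈ u∈A , lookup⇒∈ v∈A , lookup⇒∈ w∈A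

  Near : Fin n → Fin n → Set
  Near u v = ∃ λ w → Co u w × Co w v

  Near-sym : ∀ {u v} → Near u v → Near v u
  Near-sym (w , uw , wv) = w , Co-sym wv , Co-sym uw

  near⁺ : ∀ {u v} → Near u v → T (near u v)
  near⁺ (w , uw , wv) = anyFin⁺ _ (w , ∧⁺ (co⁺ uw) (co⁺ wv))

  near⁻ : ∀ {u v} → T (near u v) → Near u v
  near⁻ {u} h with anyFin⁻ _ h
  ... | w , h′ with ∧⁻ {co u w} h′
  ...   | uw , wv = w , co⁻ uw , co⁻ wv

  Clash : (Fin n → Fin n) → Fin n → Fin n → Set
  Clash col v i = ∃ λ u → v Fin.< u × col u ≡ i × Near u v

  clash⁺ : ∀ {col v i} → Clash col v i → T (clash col v i)
  clash⁺ (u , v<u , eq , uv) =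
    anyFin⁺ _ (u , ∧⁺ (ℕ.<⇒<ᵇ v<u) (∧⁺ (≡⇒≡ᵇ eq) (near⁺ uv)))

  clash⁻ : ∀ {col v i} → T (clash col v i) → Clash col v i
  clash⁻ {col} {v} {i} h with anyFin⁻ _ h
  ... | u , h′ with ∧⁻ {v <?ᵇ u} h′
  ...   | v<u , h″ with ∧⁻ {col u ≡ᵇ i} h″
  ...     | eq , uv = u , ℕ.<ᵇ⇒< (toℕ v) (toℕ u) v<u , ≡ᵇ⇒≡ eq , near⁻ uv

  -- If all n colours clashed, their witnesses would be n distinct elements above v, and v itself
  -- would make n + 1.
  free-colour : ∀ col v → ∃ λ i → ¬ T (clash col v i)
  free-colour col v = Finₚ.¬∀⟶∃¬ n _ (λ i → Bool.T? (clash col v i)) λ all →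
    ℕ.1+n≰n (Finₚ.injective⇒≤ (injective (clash⁻ ∘ all)))
    where
    module _ (clashes : ∀ i → Clash col v i) where
      witness : Fin (suc n) → Fin n
      witness zero    = v
      witness (suc i) = proj₁ (clashes i)

      col-witness : ∀ i → col (witness (suc i)) ≡ i
      col-witness i = proj₁ (proj₂ (proj₂ (clashes i)))

      v<witness : ∀ i → v Fin.< witness (suc i)
      v<witness i = proj₁ (proj₂ (clashes i))

      injective : ∀ {i j} → witness i ≡ witness j → i ≡ j
      injective {zero}  {zero}  eq = refl
      injective {zero}  {suc j} eq = ⊥-elim (Finₚ.<-irrefl eq (v<witness j))
      injective {suc i} {zero}  eq = ⊥-elim (Finₚ.<-irrefl (sym eq) (v<witness i))
      injective {suc i} {suc j} eq =
        cong suc (trans (sym (col-witness i)) (trans (cong col eq) (col-witness j)))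

  -- The first half makes the colouring proper, the second bounds the number of colours.
  LeastFree : (Fin n → Fin n) → Fin n → Set
  LeastFree col v = ¬ Clash col v (col v) × (∀ i → i Fin.< col v → Clash col v i)

  pick-leastFree : ∀ col v → ¬ Clash col v (pick col v) ×
                             (∀ i → i Fin.< pick col v → Clash col v i)
  pick-leastFree col v with foldFin-first (clash col v) id v (free-colour col v)
  ... | i , eq , free , below rewrite eq = free ∘ clash⁺ , λ j j<i → clash⁻ (below j j<i)

  -- A clash at v depends only on the colours above v, so recolouring v or a smaller element leaves
  -- it intact.
  Clash-local : ∀ {col col′ v i} → (∀ u → v Fin.< u → col u ≡ col′ u) →
                Clash col v i → Clash col′ v i
  Clash-local agree (u , v<u , eq , uv) = u , v<u , trans (sym (agree u v<u)) eq , uv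

  LeastFree-local : ∀ {col col′ v c} → (∀ u → v Fin.< u → col u ≡ col′ u) → c ≡ col′ v →
    ¬ Clash col v c × (∀ i → i Fin.< c → Clash col v i) → LeastFree col′ v
  LeastFree-local agree refl (free , below) =
    free ∘ Clash-local (λ u v<u → sym (agree u v<u)) ,
    λ i i<c → Clash-local agree (below i i<c)

  recolour-other : ∀ {v col u} → u ≢ v → recolour v col u ≡ col u
  recolour-other u≢v = if-¬T (u≢v ∘ ≡ᵇ⇒≡)

  recolour-leastFree : ∀ v col → (∀ u → suc (toℕ v) ≤ toℕ u → LeastFree col u) →
                       ∀ u → toℕ v ≤ toℕ u → LeastFree (recolour v col) u
  recolour-leastFree v col h u v≤u with u Finₚ.≟ v
  ... | yes refl = LeastFree-local
    (λ w v<w → sym (recolour-other (Finₚ.<⇒≢ v<w ∘ sym)))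
    (sym (if-T (≡⇒≡ᵇ {i = v} refl))) (pick-leastFree col v)
  ... | no u≢v = LeastFree-local
    (λ w u<w → sym (recolour-other (Finₚ.<⇒≢ (ℕ.≤-<-trans v≤u u<w) ∘ sym)))
    (sym (recolour-other u≢v))
    (h u (ℕ.≤∧≢⇒< v≤u (u≢v ∘ sym ∘ Finₚ.toℕ-injective)))

  colouring-leastFree : ∀ v → LeastFree colouring v
  colouring-leastFree v = foldFin-invariant
    (λ j col → ∀ u → j ≤ toℕ u → LeastFree col u) recolour recolour-leastFree id
    (λ u n≤u → ⊥-elim (ℕ.<⇒≱ (Finₚ.toℕ<n u) n≤u)) v z≤n

  colouring-proper : ∀ {u v} → Near u v → colouring u ≡ colouring v → u ≡ v
  colouring-proper {u} {v} uv eq with Finₚ.<-cmp u v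
  ... | tri< u<v _ _ =
    ⊥-elim (proj₁ (colouring-leastFree u) (v , u<v , sym eq , Near-sym uv))
  ... | tri≈ _ u≡v _ = u≡v
  ... | tri> _ _ v<u = ⊥-elim (proj₁ (colouring-leastFree v) (u , v<u , eq , uv))

  -- Each colour below that of v is held by an element near v, and different colours have different
  -- holders.
  colouring-bounded : ∀ v xs → (∀ u → Near u v → u ∈ˡ xs) → toℕ (colouring v) ≤ length xs
  colouring-bounded v xs near∈ = index-injective (proj₁ ∘ clashes)
    (λ {i} {j} eq → Finₚ.toℕ-injective (begin
      toℕ i                ≡⟨ Finₚ.toℕ-inject i ⟨
      toℕ (Fin.inject i)   ≡⟨ cong toℕ (trans (sym (col-clash i))
                                (trans (cong colouring eq) (col-clash j))) ⟩
      toℕ (Fin.inject j)   ≡⟨ Finₚ.toℕ-inject j ⟩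
      toℕ j                ∎))
    (λ i → near∈ _ (proj₂ (proj₂ (proj₂ (clashes i)))))
    where
    open ≡-Reasoning
    clashes : (i : Fin (toℕ (colouring v))) → Clash colouring v (Fin.inject i)
    clashes i = proj₂ (colouring-leastFree v) (Fin.inject i)
      (subst (_< toℕ (colouring v)) (sym (Finₚ.toℕ-inject i)) (Finₚ.toℕ<n i))

    col-clash : ∀ i → colouring (proj₁ (clashes i)) ≡ Fin.inject i
    col-clash i = proj₁ (proj₂ (proj₂ (clashes i)))

  neighbours : Fin n → List (Fin n)
  neighbours v = concatMap elements (filter (v Subset.∈?_) sets)

  ∈-neighbours : ∀ {u v} → Co u v → u ∈ˡ neighbours v
  ∈-neighbours {u} {v} (A , A∈ , u∈A , v∈A) = Membership.∈-concatMap⁺ elements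
    (lose (Membership.∈-filter⁺ (v Subset.∈?_) A∈ v∈A) (∈-elements⁺ u∈A))

module _ (𝒮 : SetSystem n) {k Δ} (size≤k : SetsOfSize≤ k 𝒮) (degree≤Δ : Degree≤ Δ 𝒮) where

  open Greedy (sets 𝒮)

  length-neighbours : ∀ v → length (neighbours v) ≤ Δ * k
  length-neighbours v = ℕ.≤-trans
    (length-concatMap≤ elements (filter (v Subset.∈?_) (sets 𝒮)) λ {A} A∈ →
      ℕ.≤-trans (ℕ.≤-reflexive (length-elements A))
        (size≤k (proj₁ (Membership.∈-filter⁻ (v Subset.∈?_) A∈))))
    (ℕ.*-monoˡ-≤ k (degree≤Δ v))

  colouring≤ : ∀ v → toℕ (colouring v) ≤ (Δ * k) * (Δ * k)
  colouring≤ v = ℕ.≤-trans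
    (colouring-bounded v (concatMap neighbours (neighbours v)) λ u (w , uw , wv) →
      Membership.∈-concatMap⁺ neighbours (lose (∈-neighbours wv) (∈-neighbours uw)))
    (ℕ.≤-trans (length-concatMap≤ neighbours (neighbours v) λ {w} _ → length-neighbours w)
      (ℕ.*-monoˡ-≤ (Δ * k) (length-neighbours v)))

-- Sums of fractions, and the packing condition in natural numbers

toℚᵘ-/ : ∀ {d} a → ℚ.toℚᵘ (+ a ℚ./ suc d) ℚᵘ.≃ mkℚᵘ (+ a) d
toℚᵘ-/ {d} a = ℚ.toℚᵘ-fromℚᵘ (mkℚᵘ (+ a) d)

+-/ : ∀ {d} .{{_ : ℕ.NonZero d}} a b → (+ a ℚ./ d) ℚ.+ (+ b ℚ./ d) ≡ + (a + b) ℚ./ d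
+-/ {suc d} a b = ℚ.toℚᵘ-injective (begin
  ℚ.toℚᵘ ((+ a ℚ./ suc d) ℚ.+ (+ b ℚ./ suc d))
    ≈⟨ ℚ.toℚᵘ-homo-+ (+ a ℚ./ suc d) (+ b ℚ./ suc d) ⟩
  ℚ.toℚᵘ (+ a ℚ./ suc d) ℚᵘ.+ ℚ.toℚᵘ (+ b ℚ./ suc d)
    ≈⟨ ℚᵘ.+-cong (toℚᵘ-/ a) (toℚᵘ-/ b) ⟩
  mkℚᵘ (+ a) d ℚᵘ.+ mkℚᵘ (+ b) d
    ≈⟨ *≡* same ⟩
  mkℚᵘ (+ (a + b)) d
    ≈⟨ toℚᵘ-/ (a + b) ⟨
  ℚ.toℚᵘ (+ (a + b) ℚ./ suc d) ∎)
  where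
  open ℚᵘ.≃-Reasoning
  same : (+ a ℤ.* + suc d ℤ.+ + b ℤ.* + suc d) ℤ.* + suc d ≡
         (+ (a + b)) ℤ.* (+ suc d ℤ.* + suc d)
  same = trans (cong (ℤ._* + suc d) (sym (ℤ.*-distribʳ-+ (+ suc d) (+ a) (+ b))))
               (ℤ.*-assoc (+ a ℤ.+ + b) (+ suc d) (+ suc d))

0/ : ∀ {d} .{{_ : ℕ.NonZero d}} → + 0 ℚ./ d ≡ 0ℚ
0/ {suc d} = ℚ.fromℚᵘ-cong {mkℚᵘ (+ 0) d} {ℚᵘ.0ℚᵘ} (*≡* refl)

0≤/ : ∀ {d} .{{_ : ℕ.NonZero d}} a → 0ℚ ℚ.≤ + a ℚ./ d
0≤/ {d} a = ℚ.nonNegative⁻¹ _ {{ℚ.normalize-nonNeg a d}}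

/≤1 : ∀ {d} .{{_ : ℕ.NonZero d}} a → (+ a ℚ./ d ℚ.≤ 1ℚ) ⇔ a ≤ d
/≤1 {suc d} a = mk⇔ ⇒ ⇐
  where
  ⇒ : (+ a ℚ./ suc d) ℚ.≤ 1ℚ → a ≤ suc d
  ⇒ h with ℚᵘ.≤-trans (ℚᵘ.≤-reflexive (ℚᵘ.≃-sym (toℚᵘ-/ a))) (ℚ.toℚᵘ-mono-≤ h)
  ... | *≤* h′ = ℤ.drop‿+≤+ (subst₂ ℤ._≤_ (ℤ.*-identityʳ (+ a)) (ℤ.*-identityˡ (+ suc d)) h′)

  ⇐ : a ≤ suc d → (+ a ℚ./ suc d) ℚ.≤ 1ℚ
  ⇐ h = ℚ.toℚᵘ-cancel-≤ (ℚᵘ.≤-trans (ℚᵘ.≤-reflexive (toℚᵘ-/ a))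
    (*≤* (subst₂ ℤ._≤_ (sym (ℤ.*-identityʳ (+ a))) (sym (ℤ.*-identityˡ (+ suc d)))
      (ℤ.+≤+ h))))

sumℕ : Subset n → (Fin n → ℕ) → ℕ
sumℕ S h = Vector.foldr _+_ 0 (λ v → if lookup S v then h v else 0)

sumℚ : Subset n → (Fin n → ℚ) → ℚ
sumℚ S h = Vector.foldr ℚ._+_ 0ℚ (λ v → if lookup S v then h v else 0ℚ)

sumℚ-/ : ∀ {D} .{{_ : ℕ.NonZero D}} (S : Subset n) h →
         sumℚ S (λ v → + h v ℚ./ D) ≡ + sumℕ S h ℚ./ D
sumℚ-/ []          h = sym 0/
sumℚ-/ {D = D} (true  ∷ S) h =
  trans (cong ((+ h zero ℚ./ D) ℚ.+_) (sumℚ-/ S (h ∘ suc))) (+-/ (h zero) (sumℕ S (h ∘ suc)))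
sumℚ-/ (false ∷ S) h = trans (ℚ.+-identityˡ _) (sumℚ-/ S (h ∘ suc))

seq-if : ∀ b {q : ℚ} {x : ℝ} {j} → seq x j ≡ q → seq (if b then x else 0ℝ) j ≡ (if b then q else 0ℚ)
seq-if true  eq = eq
seq-if false _  = refl

seq-sum : ∀ (S : Subset n) (x : Fin n → ℝ) (q : Fin n → ℚ) j → (∀ v → seq (x v) j ≡ q v) →
  seq (Vector.foldr _+ℝ_ 0ℝ (λ v → if lookup S v then x v else 0ℝ)) j ≡ sumℚ S q
seq-sum []      x q j eq = refl
seq-sum (b ∷ S) x q j eq =
  cong₂ ℚ._+_ (seq-if b (eq zero)) (seq-sum S (x ∘ suc) (q ∘ suc) j (eq ∘ suc))

norm-lub : ∀ (x : Vector ℝ K) j → (∀ i → ℚ.∣ seq (x i) j ∣ ℚ.≤ 1ℚ) → seq ‖ x ‖∞ j ℚ.≤ 1ℚ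
norm-lub {zero}  x j h = ℚ.nonNegative⁻¹ 1ℚ
norm-lub {suc K} x j h = ℚ.⊔-lub (h zero) (norm-lub (x ∘ suc) j (h ∘ suc))

norm-upper : ∀ (x : Vector ℝ K) j i → ℚ.∣ seq (x i) j ∣ ℚ.≤ seq ‖ x ‖∞ j
norm-upper x j zero    = ℚ.p≤p⊔q _ _
norm-upper x j (suc i) = ℚ.≤-trans (norm-upper (x ∘ suc) j i) (ℚ.p≤q⊔p ℚ.∣ seq (x zero) j ∣ _)

-- If 1 < p, density gives m strictly between them, and ε = m - 1 yields p ≤ m.
≤1+ε⇒≤1 : ∀ p → (∀ ε → 0ℚ ℚ.< ε → p ℚ.≤ 1ℚ ℚ.+ ε) → p ℚ.≤ 1ℚ
≤1+ε⇒≤1 p h = ℚ.≮⇒≥ λ 1<p → let m , 1<m , m<p = ℚ.<-dense 1<p in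
  ℚ.<-irrefl refl (ℚ.<-≤-trans m<p (subst (p ℚ.≤_) (cancel m)
    (h (m ℚ.- 1ℚ) (subst (ℚ._< m ℚ.- 1ℚ) (ℚ.+-inverseʳ 1ℚ) (ℚ.+-monoˡ-< (ℚ.- 1ℚ) 1<m)))))
  where
  cancel : ∀ m → 1ℚ ℚ.+ (m ℚ.- 1ℚ) ≡ m
  cancel m = trans (ℚ.+-comm 1ℚ (m ℚ.- 1ℚ))
    (trans (ℚ.+-assoc m (ℚ.- 1ℚ) 1ℚ) (ℚ.+-identityʳ m))

≤⇒≤ℝ : ∀ {x y} → (∀ j → seq x j ℚ.≤ seq y j) → x ≤ℝ y
≤⇒≤ℝ {x} {y} h ε 0<ε = 0 , λ j _ → ℚ.≤-trans (h j)
  (subst (ℚ._≤ seq y j ℚ.+ ε) (ℚ.+-identityʳ (seq y j)) (ℚ.+-monoʳ-≤ (seq y j) (ℚ.<⇒≤ 0<ε)))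

module _ (f : Fin n → Vector ℝ K) (num : Fin n → Fin K → ℕ) (den : Fin K → ℕ)
  .(den≢0 : ∀ i → ℕ.NonZero (den i))
  (f≡ : ∀ v i j → seq (f v i) j ≡ (+ num v i ℚ./ den i) {{den≢0 i}})
  where

  seq-sumOver : ∀ S i j →
    seq (sumOver f S i) j ≡ (+ sumℕ S (λ v → num v i) ℚ./ den i) {{den≢0 i}}
  seq-sumOver S i j = trans
    (seq-sum S (λ v → f v i) _ j (λ v → f≡ v i j))
    (sumℚ-/ {{den≢0 i}} S (λ v → num v i))

  -- The sequences are constant and each coordinate has one denominator for all elements, so the
  -- real inequality reduces to one between natural numbers.
  norm≤1⇔ : ∀ S → (‖ sumOver f S ‖∞ ≤ℝ 1ℝ) ⇔ (∀ i → sumℕ S (λ v → num v i) ≤ den i)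
  norm≤1⇔ S = mk⇔ ⇒ ⇐
    where
    absolute : ∀ i j → ℚ.∣ seq (sumOver f S i) j ∣ ≡
                       (+ sumℕ S (λ v → num v i) ℚ./ den i) {{den≢0 i}}
    absolute i j = trans (cong ℚ.∣_∣ (seq-sumOver S i j)) (ℚ.0≤p⇒∣p∣≡p (0≤/ {{den≢0 i}} (sumℕ S (λ v → num v i))))

    ⇒ : ‖ sumOver f S ‖∞ ≤ℝ 1ℝ → ∀ i → sumℕ S (λ v → num v i) ≤ den i
    ⇒ h i = Equivalence.to (/≤1 {{den≢0 i}} _) (≤1+ε⇒≤1 _ λ ε 0<ε →
      let N , h′ = h ε 0<ε in ℚ.≤-trans
        (subst (ℚ._≤ _) (absolute i N) (norm-upper (sumOver f S) N i)) (h′ N ℕ.≤-refl))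

    ⇐ : (∀ i → sumℕ S (λ v → num v i) ≤ den i) → ‖ sumOver f S ‖∞ ≤ℝ 1ℝ
    ⇐ h = ≤⇒≤ℝ {‖ sumOver f S ‖∞} {1ℝ} λ j → norm-lub (sumOver f S) j λ i →
      subst (ℚ._≤ 1ℚ) (sym (absolute i j)) (Equivalence.from (/≤1 {{den≢0 i}} _) (h i))

  in-unit-cube : (∀ v i → num v i ≤ den i) → ∀ v i → 0ℝ ≤ℝ f v i × f v i ≤ℝ 1ℝ
  in-unit-cube h v i =
    ≤⇒≤ℝ {0ℝ} {f v i} (λ j → subst (0ℚ ℚ.≤_) (sym (f≡ v i j)) (0≤/ {{den≢0 i}} (num v i))) ,
    ≤⇒≤ℝ {f v i} {1ℝ} (λ j → subst (ℚ._≤ 1ℚ) (sym (f≡ v i j))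
      (Equivalence.from (/≤1 {{den≢0 i}} _) (h v i)))

indicator : Bool → ℕ
indicator b = if b then 1 else 0

sumℕ-linear : ∀ (S : Subset n) f g →
              sumℕ S (λ v → f v + g v * 2) ≡ sumℕ S f + sumℕ S g * 2
sumℕ-linear []          f g = refl
sumℕ-linear (true  ∷ S) f g =
  trans (cong (λ x → f zero + g zero * 2 + x) (sumℕ-linear S (f ∘ suc) (g ∘ suc)))
    (solve 4 (λ a b c d → (a :+ b :* con 2) :+ (c :+ d :* con 2) :=
                          (a :+ c) :+ (b :+ d) :* con 2) refl
      (f zero) (g zero) (sumℕ S (f ∘ suc)) (sumℕ S (g ∘ suc)))
  where open ℕSolver.+-*-Solver
sumℕ-linear (false ∷ S) f g = sumℕ-linear S (f ∘ suc) (g ∘ suc)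

sumℕ-remove : ∀ {S : Subset n} {u} h → u ∈ S → h u + sumℕ (S Subset.- u) h ≤ sumℕ S h
sumℕ-remove {S = true ∷ S} h here =
  ℕ.≤-reflexive (cong (λ S → h zero + sumℕ S (h ∘ suc)) (Subset.p─⊥≡p S))
sumℕ-remove {S = true ∷ S} {suc u} h (there u∈S) = begin
  h (suc u) + (h zero + sumℕ (S Subset.- u) (h ∘ suc))
    ≡⟨ ℕ.+-assoc (h (suc u)) (h zero) _ ⟨
  h (suc u) + h zero + sumℕ (S Subset.- u) (h ∘ suc)
    ≡⟨ cong (_+ sumℕ (S Subset.- u) (h ∘ suc)) (ℕ.+-comm (h (suc u)) (h zero)) ⟩
  h zero + h (suc u) + sumℕ (S Subset.- u) (h ∘ suc)
    ≡⟨ ℕ.+-assoc (h zero) (h (suc u)) _ ⟩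
  h zero + (h (suc u) + sumℕ (S Subset.- u) (h ∘ suc))
    ≤⟨ ℕ.+-monoʳ-≤ (h zero) (sumℕ-remove (h ∘ suc) u∈S) ⟩
  h zero + sumℕ S (h ∘ suc) ∎
  where open ℕ.≤-Reasoning
sumℕ-remove {S = false ∷ S} h (there u∈S) = sumℕ-remove (h ∘ suc) u∈S

sumℕ-two : ∀ {S : Subset n} {u v} h → u ∈ S → v ∈ S → u ≢ v → h u + h v ≤ sumℕ S h
sumℕ-two {u = u} h u∈S v∈S u≢v = ℕ.≤-trans
  (ℕ.+-monoʳ-≤ (h u) (ℕ.m+n≤o⇒m≤o _
    (sumℕ-remove h (Subset.x∈p∧x≢y⇒x∈p-y v∈S (u≢v ∘ sym)))))
  (sumℕ-remove h u∈S)

sumℕ-three : ∀ {S : Subset n} {u v w} h → u ∈ S → v ∈ S → w ∈ S →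
             u ≢ v → u ≢ w → v ≢ w → h u + (h v + h w) ≤ sumℕ S h
sumℕ-three {u = u} h u∈S v∈S w∈S u≢v u≢w v≢w = ℕ.≤-trans
  (ℕ.+-monoʳ-≤ (h u) (sumℕ-two h (Subset.x∈p∧x≢y⇒x∈p-y v∈S (u≢v ∘ sym))
                                 (Subset.x∈p∧x≢y⇒x∈p-y w∈S (u≢w ∘ sym)) v≢w))
  (sumℕ-remove h u∈S)

module _ (S : Subset n) (p : Fin n → Bool) where

  private
    support : Subset n
    support = Vec.tabulate (λ v → lookup S v ∧ p v)

    sumℕ-indicator : ∀ {n} (S : Subset n) p →
      sumℕ S (indicator ∘ p) ≡ ∣ Vec.tabulate (λ v → lookup S v ∧ p v) ∣
    sumℕ-indicator []          p = refl
    sumℕ-indicator (true  ∷ S) p with p zero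
    ... | true  = cong suc (sumℕ-indicator S (p ∘ suc))
    ... | false = sumℕ-indicator S (p ∘ suc)
    sumℕ-indicator (false ∷ S) p = sumℕ-indicator S (p ∘ suc)

    sum≡ : sumℕ S (indicator ∘ p) ≡ length (elements support)
    sum≡ = trans (sumℕ-indicator S p) (sym (length-elements support))

    in-support : ∀ {v} → v ∈ˡ elements support → v ∈ S × T (p v)
    in-support {v} h
      with ∧⁻ {lookup S v} (subst T (Vec.lookup∘tabulate _ v) (∈⇒lookup (∈-elements⁻ support h)))
    ... | v∈S , pv = lookup⇒∈ v∈S , pv

  sumℕ≤1 : (∀ {u v} → u ∈ S → T (p u) → v ∈ S → T (p v) → u ≡ v) →
           sumℕ S (indicator ∘ p) ≤ 1
  sumℕ≤1 h = subst (_≤ 1) (sym sum≡)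
    (go (elements support) (elements-unique support) in-support)
    where
    go : ∀ xs → Unique xs → (∀ {v} → v ∈ˡ xs → v ∈ S × T (p v)) → length xs ≤ 1
    go []          _ _ = z≤n
    go (x ∷ [])    _ _ = s≤s z≤n
    go (x ∷ y ∷ _) ((x≢y ∷ _) ∷ _) mem with mem (here refl) | mem (there (here refl))
    ... | x∈S , px | y∈S , py = ⊥-elim (x≢y (h x∈S px y∈S py))

  sumℕ≤2 : (∀ {u v w} → u ∈ S → T (p u) → v ∈ S → T (p v) → w ∈ S → T (p w) →
              u ≢ v → u ≢ w → v ≢ w → ⊥) →
           sumℕ S (indicator ∘ p) ≤ 2
  sumℕ≤2 h = subst (_≤ 2) (sym sum≡)
    (go (elements support) (elements-unique support) in-support)
    where
    go : ∀ xs → Unique xs → (∀ {v} → v ∈ˡ xs → v ∈ S × T (p v)) → length xs ≤ 2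
    go []              _ _ = z≤n
    go (x ∷ [])        _ _ = s≤s z≤n
    go (x ∷ y ∷ [])    _ _ = s≤s (s≤s z≤n)
    go (x ∷ y ∷ z ∷ _) ((x≢y ∷ x≢z ∷ _) ∷ (y≢z ∷ _) ∷ _) mem
      with mem (here refl) | mem (there (here refl)) | mem (there (there (here refl)))
    ... | x∈S , px | y∈S , py | z∈S , pz = ⊥-elim (h x∈S px y∈S py z∈S pz x≢y x≢z y≢z)

-- Numbers as strings of binary digits

toBit : Bool → Bit
toBit false = zero
toBit true  = suc zero

number : List Bool → ℕ
number bs = fromDigits (map toBit bs)

val : ∀ {n} → (Fin n → Bool) → ℕ
val {zero}  f = 0
val {suc n} f = indicator (f zero) + val (f ∘ suc) * 2

number-bits : ∀ {n} (f : Fin n → Bool) → number (bits f) ≡ val f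
number-bits {zero}  f = refl
number-bits {suc n} f = cong₂ (λ a b → a + b * 2) (toℕ-toBit (f zero)) (number-bits (f ∘ suc))
  where
  toℕ-toBit : ∀ b → toℕ (toBit b) ≡ indicator b
  toℕ-toBit false = refl
  toℕ-toBit true  = refl

-- D = 2ⁿ - 1, kept as a string of ones.
maximal : ℕ → ℕ
maximal n = val {n} (λ _ → true)

val-mono : ∀ {n} (f g : Fin n → Bool) → (∀ p → T (f p) → T (g p)) → val f ≤ val g
val-mono {zero}  f g h = z≤n
val-mono {suc n} f g h = ℕ.+-mono-≤ (go (h zero)) (ℕ.*-monoˡ-≤ 2 (val-mono (f ∘ suc) (g ∘ suc) (h ∘ suc)))
  where
  go : ∀ {a b} → (T a → T b) → indicator a ≤ indicator b
  go {false}         _ = z≤n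
  go {true}  {true}  _ = ℕ.≤-refl
  go {true}  {false} h = ⊥-elim (h _)

val≤maximal : (f : Fin n → Bool) → val f ≤ maximal n
val≤maximal f = val-mono f (λ _ → true) (λ _ _ → _)

val-complement : ∀ {n} (f : Fin n → Bool) → val f + val (not ∘ f) ≡ maximal n
val-complement {zero}  f = refl
val-complement {suc n} f = begin
  (indicator (f zero) + x * 2) + (indicator (not (f zero)) + y * 2)
    ≡⟨ solve 4 (λ a b c d → (a :+ b :* con 2) :+ (c :+ d :* con 2) :=
                            (a :+ c) :+ (b :+ d) :* con 2) refl
         (indicator (f zero)) x (indicator (not (f zero))) y ⟩
  (indicator (f zero) + indicator (not (f zero))) + (x + y) * 2
    ≡⟨ cong₂ (λ a b → a + b * 2) (go (f zero)) (val-complement (f ∘ suc)) ⟩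
  maximal (suc n) ∎
  where
  open ≡-Reasoning
  open ℕSolver.+-*-Solver
  x y : ℕ
  x = val (f ∘ suc)
  y = val (not ∘ f ∘ suc)
  go : ∀ b → indicator b + indicator (not b) ≡ 1
  go false = refl
  go true  = refl

-- No carries arise, so positions can be split off one at a time and compared with those of the
-- string of ones.
sumℕ-val : ∀ {n m} (S : Subset n) (f : Fin n → Fin m → Bool) →
  (∀ p → sumℕ S (λ v → indicator (f v p)) ≤ 1) → sumℕ S (λ v → val (f v)) ≤ maximal m
sumℕ-val {m = zero}  S f h = ℕ.≤-reflexive (zeros S)
  where
  zeros : ∀ {n} (S : Subset n) → sumℕ S (λ _ → 0) ≡ 0
  zeros []          = refl
  zeros (true  ∷ S) = zeros S
  zeros (false ∷ S) = zeros S
sumℕ-val {m = suc m} S f h =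
  subst (_≤ maximal (suc m))
    (sym (sumℕ-linear S (λ v → indicator (f v zero)) (λ v → val (f v ∘ suc))))
    (ℕ.+-mono-≤ (h zero) (ℕ.*-monoˡ-≤ 2 (sumℕ-val S (λ v → f v ∘ suc) (h ∘ suc))))

val-code : (u : Fin n) → val (code true u) ≡ 2 ^ toℕ u
val-code {suc n} zero    = cong (λ a → 1 + a * 2) (zeros n)
  where
  zeros : ∀ n → val {n} (λ _ → false) ≡ 0
  zeros zero    = refl
  zeros (suc n) = cong (_* 2) (zeros n)
val-code {suc n} (suc u) = trans (cong (_* 2) (val-code u)) (ℕ.*-comm (2 ^ toℕ u) 2)

code-increasing : {u v : Fin n} → u Fin.< v → val (code true u) < val (code true v)
code-increasing {u = u} {v} u<v =
  subst₂ _<_ (sym (val-code u)) (sym (val-code v)) (ℕ.^-monoʳ-< 2 (s≤s (s≤s z≤n)) u<v)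

code-decreasing : {u v : Fin n} → u Fin.< v → val (code false v) < val (code false u)
code-decreasing {n} {u} {v} u<v = ℕ.+-cancelˡ-< (val (code true u)) _ _ (begin-strict
  val (code true u) + val (code false v)   <⟨ ℕ.+-monoˡ-< _ (code-increasing u<v) ⟩
  val (code true v) + val (code false v)   ≡⟨ val-complement (code true v) ⟩
  maximal n                                ≡⟨ val-complement (code true u) ⟨
  val (code true u) + val (code false u)   ∎)
  where open ℕ.≤-Reasoning

code-distinct : {u v : Fin n} → u ≢ v → ∃ λ s → val (code s u) < val (code s v)
code-distinct {u = u} {v} u≢v with Finₚ.<-cmp u v
... | tri< u<v _ _ = true , code-increasing u<v
... | tri≈ _ u≡v _ = ⊥-elim (u≢v u≡v)
... | tri> _ _ v<u = false , code-decreasing v<u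

-- Folds that build lists

foldFin-fusion : ∀ {n} (h : A → B) {g : Fin n → A → A} {g′ : Fin n → B → B} →
  (∀ i a → h (g i a) ≡ g′ i (h a)) → ∀ a → h (foldFin g a) ≡ foldFin g′ (h a)
foldFin-fusion {n = zero}  h eq a = refl
foldFin-fusion {n = suc n} h {g} {g′} eq a =
  trans (eq zero _) (cong (g′ zero) (foldFin-fusion h (eq ∘ suc) a))

foldFin-∈ : ∀ {n} {x : A} (g : Fin n → List A → List A) →
  (∀ i {xs} → x ∈ˡ xs → x ∈ˡ g i xs) → ∀ i → (∀ {xs} → x ∈ˡ g i xs) →
  ∀ {xs} → x ∈ˡ foldFin g xs
foldFin-∈ g keep zero    add = add
foldFin-∈ g keep (suc i) add = keep zero (foldFin-∈ (g ∘ suc) (keep ∘ suc) i add)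

-- Meant for indices that are colours, with B above all colours in use: the other colours contribute
-- nothing.
foldFin-length : ∀ {n} (g : Fin n → List A → List A) B {b} →
  (∀ i xs → length (g i xs) ≤ b + length xs) →
  (∀ i xs → B ≤ toℕ i → length (g i xs) ≤ length xs) →
  ∀ xs → length (foldFin g xs) ≤ B * b + length xs
foldFin-length {n = zero}  g B small none xs = ℕ.m≤n+m _ (B * _)
foldFin-length {n = suc n} g zero small none xs = ℕ.≤-trans (none zero _ z≤n)
  (foldFin-length (g ∘ suc) zero (small ∘ suc) (λ i xs _ → none (suc i) xs z≤n) xs)
foldFin-length {n = suc n} g (suc B) {b} small none xs = begin
  length (g zero (foldFin (g ∘ suc) xs))    ≤⟨ small zero _ ⟩
  b + length (foldFin (g ∘ suc) xs)         ≤⟨ ℕ.+-monoʳ-≤ b (foldFin-length (g ∘ suc) B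
                                                 (small ∘ suc) (λ i xs → none (suc i) xs ∘ s≤s) xs) ⟩
  b + (B * b + length xs)                   ≡⟨ ℕ.+-assoc b (B * b) (length xs) ⟨
  suc B * b + length xs                     ∎
  where open ℕ.≤-Reasoning

sumℕ-cong : ∀ (S : Subset n) {f g} → (∀ v → f v ≡ g v) → sumℕ S f ≡ sumℕ S g
sumℕ-cong []          eq = refl
sumℕ-cong (true  ∷ S) eq = cong₂ _+_ (eq zero) (sumℕ-cong S (eq ∘ suc))
sumℕ-cong (false ∷ S) eq = sumℕ-cong S (eq ∘ suc)

three-into-two : {u v w p q : A} → u ≢ v → u ≢ w → v ≢ w →
                 u ≡ p ⊎ u ≡ q → v ≡ p ⊎ v ≡ q → w ≡ p ⊎ w ≡ q → ⊥
three-into-two u≢v u≢w v≢w (inj₁ refl) (inj₁ refl) _           = u≢v refl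
three-into-two u≢v u≢w v≢w (inj₁ refl) (inj₂ _)    (inj₁ refl) = u≢w refl
three-into-two u≢v u≢w v≢w (inj₁ _)    (inj₂ refl) (inj₂ refl) = v≢w refl
three-into-two u≢v u≢w v≢w (inj₂ _)    (inj₁ refl) (inj₁ refl) = v≢w refl
three-into-two u≢v u≢w v≢w (inj₂ refl) (inj₁ _)    (inj₂ refl) = u≢w refl
three-into-two u≢v u≢w v≢w (inj₂ refl) (inj₂ refl) _           = u≢v refl

-- Soundness and completeness of the coordinates

-- `v₀` witnesses that the universe is nonempty, which makes D and hence the denominators positive.
module Packing {n} (v₀ : Fin n) (𝒮 : SetSystem n) (col : Fin n → Fin n)
  (proper : ∀ {u v} → Greedy.Near (sets 𝒮) u v → col u ≡ col v → u ≡ v)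
  where

  open Greedy (sets 𝒮)
  open Coordinates col

  private
    V : Set
    V = Fin n

    D : ℕ
    D = maximal n

    0<D : 0 < D
    0<D = go v₀
      where
      go : ∀ {n} → Fin n → 0 < maximal n
      go zero    = s≤s z≤n
      go (suc _) = s≤s z≤n

  module _ {s : Bool} {a b v p : V} where

    bit-shown : col v ≢ b → col v ≡ a → T (code s v p) → T (bit s a b v p)
    bit-shown v≢b v≡a h = subst T (sym (if-¬T (v≢b ∘ ≡ᵇ⇒≡))) (∧⁺ (≡⇒≡ᵇ v≡a) h)

    bit-shown⁻ : col v ≢ b → T (bit s a b v p) → col v ≡ a × T (code s v p)
    bit-shown⁻ v≢b h with ∧⁻ {col v ≡ᵇ a} (subst T (if-¬T (v≢b ∘ ≡ᵇ⇒≡)) h)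
    ... | v≡a , h′ = ≡ᵇ⇒≡ v≡a , h′

    bit-hidden : col v ≡ b → (∀ u → col u ≡ a → u ≢ v → Co u v → ¬ T (code s u p)) →
                 T (bit s a b v p)
    bit-hidden v≡b h = subst T (sym (if-T (≡⇒≡ᵇ v≡b))) (not⁺ none)
      where
      none : ¬ T (anyFin λ u → (col u ≡ᵇ a) ∧ (not (u ≡ᵇ v) ∧ (co u v ∧ code s u p)))
      none any with anyFin⁻ _ any
      ... | u , h₁ with ∧⁻ {col u ≡ᵇ a} h₁
      ... | u≡a , h₂ with ∧⁻ {not (u ≡ᵇ v)} h₂
      ... | u≢v , h₃ with ∧⁻ {co u v} h₃
      ... | uv , h₄ = h u (≡ᵇ⇒≡ u≡a) (not⁻ u≢v ∘ ≡⇒≡ᵇ) (co⁻ uv) h₄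

    bit-hidden⁻ : col v ≡ b → T (bit s a b v p) →
                  ∀ u → col u ≡ a → u ≢ v → Co u v → ¬ T (code s u p)
    bit-hidden⁻ v≡b h u u≡a u≢v uv h′ = not⁻ (subst T (if-T (≡⇒≡ᵇ v≡b)) h)
      (anyFin⁺ _ (u , ∧⁺ (≡⇒≡ᵇ u≡a) (∧⁺ (not⁺ (u≢v ∘ ≡ᵇ⇒≡)) (∧⁺ (co⁺ uv) h′))))

  Co⇒Near : ∀ {u v} → Co u v → Near u v
  Co⇒Near {v = v} uv@(A , A∈ , _ , v∈A) = v , uv , (A , A∈ , v∈A , v∈A)

  Co-proper : ∀ {u v} → Co u v → col u ≡ col v → u ≡ v
  Co-proper = proper ∘ Co⇒Near

  -- If both or neither have colour b, their colours agree (a digit 1 outside colour b forces colour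
  -- a), and properness applies. Otherwise the one of colour b has digit 0 wherever the other, being
  -- its partner, has digit 1.
  bit-exclusive : ∀ {s a b u v p} → Co u v →
                  T (bit s a b u p) → T (bit s a b v p) → u ≡ v
  bit-exclusive {s} {a} {b} {u} {v} uv hu hv with col u Finₚ.≟ b | col v Finₚ.≟ b | u Finₚ.≟ v
  ... | _       | _       | yes u≡v = u≡v
  ... | yes u≡b | yes v≡b | _ = Co-proper uv (trans u≡b (sym v≡b))
  ... | no  u≢b | no  v≢b | _ = Co-proper uv
    (trans (proj₁ (bit-shown⁻ {s} u≢b hu)) (sym (proj₁ (bit-shown⁻ {s} v≢b hv))))
  ... | yes u≡b | no  v≢b | no u≢v = let v≡a , h = bit-shown⁻ {s} v≢b hv in
    ⊥-elim (bit-hidden⁻ {s} u≡b hu v v≡a (u≢v ∘ sym) (Co-sym uv) h)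
  ... | no  u≢b | yes v≡b | no u≢v = let u≡a , h = bit-shown⁻ {s} u≢b hu in
    ⊥-elim (bit-hidden⁻ {s} v≡b hv u u≡a u≢v uv h)

  pairs-sound : ∀ {S} s a b → (𝒮 ↓) S → sumℕ S (λ v → val (bit s a b v)) ≤ D
  pairs-sound {S} s a b (A , A∈ , S⊆A) = sumℕ-val S (bit s a b) λ p →
    sumℕ≤1 S (λ v → bit s a b v p) λ u∈S hu v∈S hv →
      bit-exclusive {s} {a} {b} {p = p} (A , A∈ , S⊆A u∈S , S⊆A v∈S) hu hv

  bit-full : ∀ {s a b v} → col v ≡ b → (∀ u → col u ≡ a → u ≢ v → ¬ Co u v) →
             val (bit s a b v) ≡ D
  bit-full {s} {a} {b} {v} v≡b lonely = ℕ.≤-antisym (val≤maximal (bit s a b v))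
    (val-mono (λ _ → true) (bit s a b v) λ p _ → bit-hidden {s} v≡b
      λ u u≡a u≢v uv _ → lonely u u≡a u≢v uv)

  pairs-separate : ∀ {u v} → u ≢ v → ¬ Co u v →
    ∃ λ s → D < val (bit s (col u) (col v) u) + val (bit s (col u) (col v) v)
  pairs-separate {u} {v} u≢v ¬uv with col u Finₚ.≟ col v
  ... | yes eq = true , subst₂ (λ x y → D < x + y)
    (sym (bit-full {true} eq λ w w≡ w≢u wu → w≢u (Co-proper wu w≡)))
    (sym (bit-full {true} refl λ w w≡ w≢v wv → w≢v (Co-proper wv (trans w≡ eq))))
    (ℕ.m<m+n D 0<D)
  ... | no u≁v with Finₚ.any? (λ w → (col w Finₚ.≟ col u) ×-dec Bool.T? (co w v))
  -- Here v has no partner and reaches D alone, while x(u) = 2^u is positive.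
  ...   | no none = true , (begin-strict
    D                                                        <⟨ ℕ.m<n+m D 0<code ⟩
    val (code true u) + D                                    ≤⟨ ℕ.+-mono-≤
      (val-mono (code true u) (bit true (col u) (col v) u) λ p → bit-shown {true} u≁v refl)
      (ℕ.≤-reflexive (sym (bit-full {true} refl λ w w≡ _ wv → none (w , w≡ , co⁺ wv)))) ⟩
    val (bit true (col u) (col v) u) + val (bit true (col u) (col v) v) ∎)
    where
    open ℕ.≤-Reasoning
    0<code : 0 < val (code true u)
    0<code = subst (0 <_) (sym (val-code u)) (ℕ.m^n>0 2 (toℕ u))
  -- The choice of s puts the number of u above that of the partner w; the two numerators are at
  -- least the former and D minus the latter.
  ...   | yes (w , w≡ , wv) = s , (begin-strict
    D                                                        ≡⟨ val-complement (code s w) ⟨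
    val (code s w) + val (not ∘ code s w)                    <⟨ ℕ.+-monoˡ-< _ w<u ⟩
    val (code s u) + val (not ∘ code s w)                    ≤⟨ ℕ.+-mono-≤
      (val-mono (code s u) (bit s (col u) (col v) u) λ p → bit-shown {s} u≁v refl)
      (val-mono (not ∘ code s w) (bit s (col u) (col v) v) λ p h → bit-hidden {s} refl λ x x≡ _ xv →
        subst (λ y → ¬ T (code s y p)) (unique x≡ xv) (not⁻ h)) ⟩
    val (bit s (col u) (col v) u) + val (bit s (col u) (col v) v) ∎)
    where
    open ℕ.≤-Reasoning
    w≢u : w ≢ u
    w≢u refl = ¬uv (co⁻ wv)
    -- Two candidates both share a set with v, hence are near each other. This is where a colouring
    -- at distance two is required.
    unique : ∀ {x} → col x ≡ col u → Co x v → w ≡ x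
    unique x≡ xv = proper (v , co⁻ wv , Co-sym xv) (trans w≡ (sym x≡))
    s = proj₁ (code-distinct w≢u)
    w<u = proj₂ (code-distinct w≢u)

  record Bad (a b c v : V) : Set where
    field
      x y z  : V
      x≡a    : col x ≡ a
      y≡b    : col y ≡ b
      z≡c    : col z ≡ c
      xy     : Co x y
      yz     : Co y z
      xz     : Co x z
      apart  : ¬ Common x y z
      member : v ≡ x ⊎ v ≡ y ⊎ v ≡ z

  module _ {a b c v : V} where

    bad⁺ : Bad a b c v → T (bad a b c v)
    bad⁺ h = anyFin⁺ _ (x , anyFin⁺ _ (y , anyFin⁺ _ (z ,
      ∧⁺ (≡⇒≡ᵇ x≡a) (∧⁺ (≡⇒≡ᵇ y≡b) (∧⁺ (≡⇒≡ᵇ z≡c)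
      (∧⁺ (co⁺ xy) (∧⁺ (co⁺ yz) (∧⁺ (co⁺ xz)
      (∧⁺ (not⁺ (apart ∘ common⁻)) (not⁺ (outside member)))))))))))
      where
      open Bad h
      outside : v ≡ x ⊎ v ≡ y ⊎ v ≡ z → ¬ T (not (v ≡ᵇ x) ∧ (not (v ≡ᵇ y) ∧ not (v ≡ᵇ z)))
      outside mem n = let v≢x , n′ = ∧⁻ {not (v ≡ᵇ x)} n
                          v≢y , v≢z = ∧⁻ {not (v ≡ᵇ y)} n′ in
        case mem of λ
          { (inj₁ v≡x)        → not⁻ v≢x (≡⇒≡ᵇ v≡x)
          ; (inj₂ (inj₁ v≡y)) → not⁻ v≢y (≡⇒≡ᵇ v≡y)
          ; (inj₂ (inj₂ v≡z)) → not⁻ v≢z (≡⇒≡ᵇ v≡z) }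

    bad⁻ : T (bad a b c v) → Bad a b c v
    bad⁻ h with anyFin⁻ _ h
    ... | x , h₁ with anyFin⁻ _ h₁
    ... | y , h₂ with anyFin⁻ _ h₂
    ... | z , h₃ with ∧⁻ {col x ≡ᵇ a} h₃
    ... | x≡a , h₄ with ∧⁻ {col y ≡ᵇ b} h₄
    ... | y≡b , h₅ with ∧⁻ {col z ≡ᵇ c} h₅
    ... | z≡c , h₆ with ∧⁻ {co x y} h₆
    ... | xy , h₇ with ∧⁻ {co y z} h₇
    ... | yz , h₈ with ∧⁻ {co x z} h₈
    ... | xz , h₉ with ∧⁻ {not (common x y z)} h₉
    ... | apart , member = record
      { x = x ; y = y ; z = z
      ; x≡a = ≡ᵇ⇒≡ x≡a ; y≡b = ≡ᵇ⇒≡ y≡b ; z≡c = ≡ᵇ⇒≡ z≡c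
      ; xy = co⁻ xy ; yz = co⁻ yz ; xz = co⁻ xz
      ; apart = not⁻ apart ∘ common⁺
      ; member = inside (not⁻ member) }
      where
      inside : ∀ {x y z} → ¬ T (not (v ≡ᵇ x) ∧ (not (v ≡ᵇ y) ∧ not (v ≡ᵇ z))) →
               v ≡ x ⊎ v ≡ y ⊎ v ≡ z
      inside {x} {y} {z} h with v Finₚ.≟ x | v Finₚ.≟ y | v Finₚ.≟ z
      ... | yes v≡x | _       | _       = inj₁ v≡x
      ... | no _    | yes v≡y | _       = inj₂ (inj₁ v≡y)
      ... | no _    | no _    | yes v≡z = inj₂ (inj₂ v≡z)
      ... | no v≢x  | no v≢y  | no v≢z  = ⊥-elim (h
        (∧⁺ (not⁺ (v≢x ∘ ≡ᵇ⇒≡)) (∧⁺ (not⁺ (v≢y ∘ ≡ᵇ⇒≡)) (not⁺ (v≢z ∘ ≡ᵇ⇒≡)))))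

  bad-colour : ∀ {a b c v} → Bad a b c v → col v ≡ a ⊎ col v ≡ b ⊎ col v ≡ c
  bad-colour h with Bad.member h
  ... | inj₁ refl        = inj₁ (Bad.x≡a h)
  ... | inj₂ (inj₁ refl) = inj₂ (inj₁ (Bad.y≡b h))
  ... | inj₂ (inj₂ refl) = inj₂ (inj₂ (Bad.z≡c h))

  -- All bad elements of a set A lie in the bad triple of any one of them,
  -- as they are near its members and share their colours.
  module _ {A} (A∈ : A ∈ˡ sets 𝒮) {a b c u} (u∈A : u ∈ A) (h : Bad a b c u) where

    open Bad h

    private
      Co-refl₁ : ∀ {p q} → Co p q → Co p p
      Co-refl₁ (B , B∈ , p∈ , _) = B , B∈ , p∈ , p∈

      u-x : Co u x
      u-x with member
      ... | inj₁ refl        = Co-refl₁ xy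
      ... | inj₂ (inj₁ refl) = Co-sym xy
      ... | inj₂ (inj₂ refl) = Co-sym xz

      u-y : Co u y
      u-y with member
      ... | inj₁ refl        = xy
      ... | inj₂ (inj₁ refl) = Co-refl₁ yz
      ... | inj₂ (inj₂ refl) = Co-sym yz

      u-z : Co u z
      u-z with member
      ... | inj₁ refl        = xz
      ... | inj₂ (inj₁ refl) = yz
      ... | inj₂ (inj₂ refl) = Co-refl₁ (Co-sym xz)

    bad-in-triple : ∀ {t} → t ∈ A → Bad a b c t → t ≡ x ⊎ t ≡ y ⊎ t ≡ z
    bad-in-triple {t} t∈A h′ with bad-colour h′
    ... | inj₁ t≡a        =
      inj₁ (proper (u , (A , A∈ , t∈A , u∈A) , u-x) (trans t≡a (sym x≡a)))
    ... | inj₂ (inj₁ t≡b) =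
      inj₂ (inj₁ (proper (u , (A , A∈ , t∈A , u∈A) , u-y) (trans t≡b (sym y≡b))))
    ... | inj₂ (inj₂ t≡c) =
      inj₂ (inj₂ (proper (u , (A , A∈ , t∈A , u∈A) , u-z) (trans t≡c (sym z≡c))))

    -- The triple has no common set, so one of its members is outside A, and three distinct elements
    -- would have to be among the other two.
    at-most-two-bad : ∀ {v w} → v ∈ A → Bad a b c v → w ∈ A → Bad a b c w →
                      u ≢ v → u ≢ w → v ≢ w → ⊥
    at-most-two-bad v∈A hv w∈A hw u≢v u≢w v≢w
      with x Subset.∈? A | y Subset.∈? A | z Subset.∈? A
    ... | yes x∈A | yes y∈A | yes z∈A = apart (A , A∈ , x∈A , y∈A , z∈A)
    ... | no x∉A  | _       | _       =
      three-into-two u≢v u≢w v≢w (drop u∈A h) (drop v∈A hv) (drop w∈A hw)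
      where
      drop : ∀ {t} → t ∈ A → Bad a b c t → t ≡ y ⊎ t ≡ z
      drop t∈A ht with bad-in-triple t∈A ht
      ... | inj₁ refl = ⊥-elim (x∉A t∈A)
      ... | inj₂ t≡   = t≡
    ... | _       | no y∉A  | _       =
      three-into-two u≢v u≢w v≢w (drop u∈A h) (drop v∈A hv) (drop w∈A hw)
      where
      drop : ∀ {t} → t ∈ A → Bad a b c t → t ≡ x ⊎ t ≡ z
      drop t∈A ht with bad-in-triple t∈A ht
      ... | inj₁ t≡x         = inj₁ t≡x
      ... | inj₂ (inj₁ refl) = ⊥-elim (y∉A t∈A)
      ... | inj₂ (inj₂ t≡z)  = inj₂ t≡z
    ... | _       | _       | no z∉A  =
      three-into-two u≢v u≢w v≢w (drop u∈A h) (drop v∈A hv) (drop w∈A hw)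
      where
      drop : ∀ {t} → t ∈ A → Bad a b c t → t ≡ x ⊎ t ≡ y
      drop t∈A ht with bad-in-triple t∈A ht
      ... | inj₁ t≡x         = inj₁ t≡x
      ... | inj₂ (inj₁ t≡y)  = inj₂ t≡y
      ... | inj₂ (inj₂ refl) = ⊥-elim (z∉A t∈A)

  triples-sound : ∀ {S} a b c → (𝒮 ↓) S → sumℕ S (indicator ∘ bad a b c) ≤ 2
  triples-sound {S} a b c (A , A∈ , S⊆A) = sumℕ≤2 S (bad a b c)
    λ u∈S hu v∈S hv w∈S hw → at-most-two-bad A∈ {a} {b} {c} (S⊆A u∈S) (bad⁻ hu)
      (S⊆A v∈S) (bad⁻ hv) (S⊆A w∈S) (bad⁻ hw)

  module _ {S : Subset n}
    (pairs-ok : ∀ s u v → sumℕ S (λ w → val (bit s (col u) (col v) w)) ≤ D)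
    (triples-ok : ∀ u v w → sumℕ S (indicator ∘ bad (col u) (col v) (col w)) ≤ 2)
    where

    pairs-complete : ∀ {u v} → u ∈ S → v ∈ S → u ≢ v → Co u v
    pairs-complete {u} {v} u∈S v∈S u≢v with Bool.T? (co u v)
    ... | yes uv = co⁻ uv
    ... | no ¬uv with pairs-separate u≢v (¬uv ∘ co⁺)
    ...   | s , D< = contradiction
      (ℕ.≤-trans (sumℕ-two (λ w → val (bit s (col u) (col v) w)) u∈S v∈S u≢v) (pairs-ok s u v))
      (ℕ.<⇒≱ D<)

    -- The pairs already share sets, so without a common set all three are bad for their own colours
    -- and contribute three halves.
    triples-complete : ∀ {x y z} → x ∈ S → y ∈ S → z ∈ S → x ≢ y → x ≢ z → y ≢ z →
                       Common x y z
    triples-complete {x} {y} {z} x∈S y∈S z∈S x≢y x≢z y≢z with Bool.T? (common x y z)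
    ... | yes h = common⁻ h
    ... | no ¬h = ⊥-elim (ℕ.1+n≰n (ℕ.≤-trans (three
        (sumℕ-three (indicator ∘ bad (col x) (col y) (col z)) x∈S y∈S z∈S x≢y x≢z y≢z))
        (triples-ok x y z)))
      where
      isBad : ∀ {v} → v ≡ x ⊎ v ≡ y ⊎ v ≡ z → T (bad (col x) (col y) (col z) v)
      isBad mem = bad⁺ record
        { x = x ; y = y ; z = z ; x≡a = refl ; y≡b = refl ; z≡c = refl
        ; xy = pairs-complete x∈S y∈S x≢y
        ; yz = pairs-complete y∈S z∈S y≢z
        ; xz = pairs-complete x∈S z∈S x≢z
        ; apart = ¬h ∘ common⁺ ; member = mem }
      one : ∀ {v} → v ≡ x ⊎ v ≡ y ⊎ v ≡ z → indicator (bad (col x) (col y) (col z) v) ≡ 1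
      one mem = if-T (isBad mem)
      three : ∀ {t} → indicator (bad (col x) (col y) (col z) x) +
                      (indicator (bad (col x) (col y) (col z) y) +
                       indicator (bad (col x) (col y) (col z) z)) ≤ t → 3 ≤ t
      three {t} = subst (_≤ t) (cong₂ _+_ (one (inj₁ refl))
        (cong₂ _+_ (one (inj₂ (inj₁ refl))) (one (inj₂ (inj₂ refl)))))

    -- Nontriviality covers subsets with at most one element. Otherwise two elements u, w share a
    -- set A, and the set that they share with a further z is A again by simplicity.
    complete : Simple 𝒮 → NonTrivial 𝒮 → (𝒮 ↓) S
    complete simple nontrivial with Subset.nonempty? S
    ... | no empty = let A , A∈ , _ = nontrivial v₀ in
      A , A∈ , λ v∈S → ⊥-elim (empty (_ , v∈S))
    ... | yes (u , u∈S) with Finₚ.any? (λ w → (w Subset.∈? S) ×-dec ¬? (u Finₚ.≟ w))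
    ...   | no none = let A , A∈ , u∈A = nontrivial u in A , A∈ , λ {w} w∈S →
      subst (_∈ A) (decidable-stable (u Finₚ.≟ w) λ u≢w → none (w , w∈S , u≢w)) u∈A
    ...   | yes (w , w∈S , u≢w) with pairs-complete u∈S w∈S u≢w
    ...     | A , A∈ , u∈A , w∈A = A , A∈ , λ {z} z∈S →
      decidable-stable (z Subset.∈? A) λ z∉A →
        let u≢z = λ u≡z → z∉A (subst (_∈ A) u≡z u∈A)
            w≢z = λ w≡z → z∉A (subst (_∈ A) w≡z w∈A)
            B , B∈ , u∈B , w∈B , z∈B = triples-complete u∈S w∈S z∈S u≢w u≢z w≢z
        in z∉A (subst (z ∈_)
             (sym (simple-≡ 𝒮 simple A∈ B∈ u≢w u∈A w∈A u∈B w∈B)) z∈B)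

  -- The list of coordinates and the matrix of the embedding

  coordinates : List (Coordinate n)
  coordinates = forUsed id

  private
    emit : (Coordinate n → A) → V → V → V → List A → List A
    emit f a b c xs = if used a ∧ (used b ∧ used c)
      then f (pairs true a b) ∷ f (pairs false a b) ∷ f (triples a b c) ∷ xs
      else xs

  -- Rows are computed separately; this aligns them, so that equal positions belong to the same
  -- coordinate.
  map-forUsed : (f : Coordinate n → A) → map f coordinates ≡ forUsed f
  map-forUsed f = foldFin-fusion (map f) {λ a → foldFin λ b → foldFin (emit id a b)}
    (λ a → foldFin-fusion (map f) {λ b → foldFin (emit id a b)}
      (λ b → foldFin-fusion (map f) {emit id a b}
        (λ c xs → Bool.if-float (map f) (used a ∧ (used b ∧ used c))))) []

  used-col : ∀ v → T (used (col v))
  used-col v = anyFin⁺ _ (v , ≡⇒≡ᵇ {i = col v} refl)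

  module _ (u v w : V) where

    private
      Emitted : Coordinate n → Set
      Emitted x = ∀ {xs} → x ∈ˡ emit id (col u) (col v) (col w) xs

      keep : ∀ {x} a b c {xs} → x ∈ˡ xs → x ∈ˡ emit id a b c xs
      keep a b c x∈ with used a ∧ (used b ∧ used c)
      ... | true  = there (there (there x∈))
      ... | false = x∈

      keep-fold : ∀ {x} (g : V → List (Coordinate n) → List (Coordinate n)) →
        (∀ i {xs} → x ∈ˡ xs → x ∈ˡ g i xs) → ∀ {xs} → x ∈ˡ xs → x ∈ˡ foldFin g xs
      keep-fold {x} g h = foldFin-invariant (λ _ xs → x ∈ˡ xs) g (λ i _ → h i) _

      emitted : ∀ {x} → Emitted x → x ∈ˡ coordinates
      emitted e = foldFin-∈ _
        (λ a → keep-fold _ λ b → keep-fold _ λ c → keep a b c) (col u)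
        (foldFin-∈ _ (λ b → keep-fold _ λ c → keep (col u) b c) (col v)
          (foldFin-∈ _ (λ c → keep (col u) (col v) c) (col w) e))

      emit-≡ : ∀ {x xs} → x ∈ˡ pairs true (col u) (col v) ∷ pairs false (col u) (col v) ∷
                               triples (col u) (col v) (col w) ∷ xs →
               x ∈ˡ emit id (col u) (col v) (col w) xs
      emit-≡ = subst (_ ∈ˡ_) (sym (if-T (∧⁺ (used-col u) (∧⁺ (used-col v) (used-col w)))))

    pairs∈ : ∀ s → pairs s (col u) (col v) ∈ˡ coordinates
    pairs∈ true  = emitted λ {xs} → emit-≡ {xs = xs} (here refl)
    pairs∈ false = emitted λ {xs} → emit-≡ {xs = xs} (there (here refl))

    triples∈ : triples (col u) (col v) (col w) ∈ˡ coordinates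
    triples∈ = emitted λ {xs} → emit-≡ {xs = xs} (there (there (here refl)))

  length-coordinates : ∀ B → (∀ v → toℕ (col v) < B) →
                       length coordinates ≤ B * (B * (B * 3))
  length-coordinates B col<B = subst (length coordinates ≤_) (ℕ.+-identityʳ _)
    (foldFin-length _ B
      (λ a → foldFin-length _ B
        (λ b → foldFin-length _ B (λ c xs → emit≤ a b c xs)
          (λ c xs B≤c → unused (λ (_ , _ , hc) → unused-colour c B≤c hc)))
        (λ b xs B≤b → shorter (emit id a b) (λ c xs → unused λ (_ , hb , _) →
          unused-colour b B≤b hb) xs))
      (λ a xs B≤a → shorter (λ b → foldFin (emit id a b)) (λ b → shorter (emit id a b)
        (λ c xs → unused λ (ha , _) → unused-colour a B≤a ha)) xs) [])
    where
    emit≤ : ∀ a b c xs → length (emit id a b c xs) ≤ 3 + length xs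
    emit≤ a b c xs with used a ∧ (used b ∧ used c)
    ... | true  = ℕ.≤-refl
    ... | false = ℕ.m≤n+m _ 3

    unused-colour : ∀ a → B ≤ toℕ a → ¬ T (used a)
    unused-colour a B≤a h with anyFin⁻ _ h
    ... | v , v≡ with ≡ᵇ⇒≡ {i = col v} v≡
    ...   | refl = ℕ.<⇒≱ (col<B v) B≤a

    unused : ∀ {a b c xs} → ¬ (T (used a) × T (used b) × T (used c)) →
             length (emit id a b c xs) ≤ length xs
    unused {a} h = ℕ.≤-reflexive (cong length
      (if-¬T λ t → let ha , t′ = ∧⁻ {used a} t in h (ha , ∧⁻ t′)))

    shorter : ∀ {A : Set} (g : V → List A → List A) →
              (∀ i xs → length (g i xs) ≤ length xs) →
              ∀ xs → length (foldFin g xs) ≤ length xs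
    shorter g h xs = foldFin-invariant (λ _ ys → length ys ≤ length xs) g
      (λ i ys → ℕ.≤-trans (h i ys)) xs ℕ.≤-refl

  -- Depends on the coordinate only, so that sums over elements can be compared through their
  -- numerators.
  denominator : Coordinate n → ℕ
  denominator (pairs _ _ _)   = number (bits {n} (λ _ → true))
  denominator (triples _ _ _) = 2

  denominator-nonZero : ∀ c → ℕ.NonZero (denominator c)
  denominator-nonZero (pairs _ _ _)   =
    ℕ.>-nonZero (subst (0 <_) (sym (number-bits {n} (λ _ → true))) 0<D)
  denominator-nonZero (triples _ _ _) = _

  number-denominator : ∀ v c → number (proj₂ (entry v c)) ≡ denominator c
  number-denominator v (pairs _ _ _)   = refl
  number-denominator v (triples _ _ _) = refl

  fraction : V → Coordinate n → BinaryFraction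
  fraction v c = mkFraction (map toBit (proj₁ (entry v c))) (map toBit (proj₂ (entry v c)))
    (subst ℕ.NonZero (sym (number-denominator v c)) (denominator-nonZero c))

  numerator : V → Coordinate n → ℕ
  numerator v c = number (proj₁ (entry v c))

  value-fraction : ∀ v c → value (fraction v c) ≡
                   (+ numerator v c ℚ./ denominator c) {{denominator-nonZero c}}
  value-fraction v (pairs _ _ _)   = refl
  value-fraction v (triples _ _ _) = refl

  numerator≤denominator : ∀ v c → numerator v c ≤ denominator c
  numerator≤denominator v (pairs s a b) = subst₂ _≤_
    (sym (number-bits (bit s a b v))) (sym (number-bits {n} (λ _ → true)))
    (val≤maximal (bit s a b v))
  numerator≤denominator v (triples a b c) with bad a b c v
  ... | false = z≤n
  ... | true  = s≤s z≤n

  sum-pairs : ∀ S s a b →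
    sumℕ S (λ v → numerator v (pairs s a b)) ≤ denominator (pairs s a b) ⇔
    sumℕ S (λ v → val (bit s a b v)) ≤ D
  sum-pairs S s a b = mk⇔ (subst₂ _≤_ num den) (subst₂ _≤_ (sym num) (sym den))
    where
    num = sumℕ-cong S (λ v → number-bits (bit s a b v))
    den = number-bits {n} (λ _ → true)

  sum-triples : ∀ S a b c →
    sumℕ S (λ v → numerator v (triples a b c)) ≡ sumℕ S (indicator ∘ bad a b c)
  sum-triples S a b c = sumℕ-cong S λ v → go (bad a b c v)
    where
    go : ∀ b → number (b ∷ []) ≡ indicator b
    go false = refl
    go true  = refl

  sound : ∀ {S} → (𝒮 ↓) S → ∀ c → sumℕ S (λ v → numerator v c) ≤ denominator c
  sound {S} h (pairs s a b)   = Equivalence.from (sum-pairs S s a b) (pairs-sound s a b h)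
  sound {S} h (triples a b c) = subst (_≤ 2) (sym (sum-triples S a b c)) (triples-sound a b c h)

  matrix : Vec (Vec BinaryFraction (length coordinates)) n
  matrix = Vec.tabulate λ v → Vec.tabulate λ i → fraction v (List.lookup coordinates i)

  matrix-isEmbedding : Simple 𝒮 → NonTrivial 𝒮 → IsEmbedding (𝒮 ↓) (realMap matrix)
  matrix-isEmbedding simple nontrivial = record
    { unit-cube = in-unit-cube (realMap matrix) num den den≢0 entries
        (λ v i → numerator≤denominator v (coordinate i))
    ; packs = λ S → mk⇔
        (λ h → Equivalence.from (packing S) (λ i → sound h (coordinate i)))
        (λ h → let ok = at S (Equivalence.to (packing S) h) in
          complete (λ s u v → Equivalence.to (sum-pairs S s (col u) (col v))
                      -- Any used colour may stand in third place; that of v is taken.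
                      (ok (pairs∈ u v v s)))
                   (λ u v w → subst (_≤ 2) (sum-triples S (col u) (col v) (col w))
                      (ok (triples∈ u v w)))
                   simple nontrivial)
    }
    where
    coordinate = List.lookup coordinates

    num : V → Fin (length coordinates) → ℕ
    num v i = numerator v (coordinate i)

    den : Fin (length coordinates) → ℕ
    den i = denominator (coordinate i)

    den≢0 : ∀ i → ℕ.NonZero (den i)
    den≢0 i = denominator-nonZero (coordinate i)

    entries : ∀ v i j → seq (realMap matrix v i) j ≡ (+ num v i ℚ./ den i) {{den≢0 i}}
    entries v i j = trans
      (cong value (trans (cong (λ row → lookup row i) (Vec.lookup∘tabulate _ v))
                         (Vec.lookup∘tabulate _ i)))
      (value-fraction v (coordinate i))

    packing = norm≤1⇔ (realMap matrix) num den den≢0 entries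

    at : ∀ S → (∀ i → sumℕ S (λ v → num v i) ≤ den i) →
         ∀ {c} → c ∈ˡ coordinates → sumℕ S (λ v → numerator v c) ≤ denominator c
    at S ok c∈ = subst (λ c → sumℕ S (λ v → numerator v c) ≤ denominator c)
      (sym (Any.lookup-index c∈)) (ok (Any.index c∈))

  -- Bits and Booleans are stored as the same trees, so the digit lists of the program are already
  -- in output format.
  encodeBits : ∀ bs → encodeList encodeBit (map toBit bs) ≡ encodeList encodeBool bs
  encodeBits []           = refl
  encodeBits (false ∷ bs) = cong (node leaf) (encodeBits bs)
  encodeBits (true  ∷ bs) = cong (node (node leaf leaf)) (encodeBits bs)

  encodeVector-cong : ∀ {n} {A B : Set} {enc : A → Tree} {enc′ : B → Tree} {f g} →
    (∀ (i : Fin n) → enc (f i) ≡ enc′ (g i)) → encodeVector enc f ≡ encodeVector enc′ g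
  encodeVector-cong {zero}  eq = refl
  encodeVector-cong {suc n} eq = cong₂ node (eq zero) (encodeVector-cong (eq ∘ suc))

  encodeVector-lookup : ∀ {A B : Set} {enc : B → Tree} (f : A → B) xs →
    encodeVector enc (f ∘ List.lookup xs) ≡ encodeList enc (map f xs)
  encodeVector-lookup f []       = refl
  encodeVector-lookup f (x ∷ xs) = cong (node _) (encodeVector-lookup f xs)

  encode-matrix : encodeMatrix matrix ≡
                  encode (vec (list fractionTy)) (λ v → forUsed (entry v))
  encode-matrix = encodeVector-cong λ v → begin
    encodeVector encodeFraction (fraction v ∘ List.lookup coordinates)
      ≡⟨ encodeVector-cong (λ i → cong₂ node (encodeBits _) (encodeBits _)) ⟩
    encodeVector (encode {n} fractionTy) (entry v ∘ List.lookup coordinates)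
      ≡⟨ encodeVector-lookup (entry v) coordinates ⟩
    encodeList (encode {n} fractionTy) (map (entry v) coordinates)
      ≡⟨ cong (encodeList (encode {n} fractionTy)) (map-forUsed (entry v)) ⟩
    encodeList (encode {n} fractionTy) (forUsed (entry v)) ∎
    where open ≡-Reasoning

-- The program and the explicit bounds

∈⇒length>0 : ∀ {A : Set} {x : A} {xs} → x ∈ˡ xs → 1 ≤ length xs
∈⇒length>0 {xs = _ ∷ _} _ = s≤s z≤n

unary-size : ∀ n → encodeVec encodeBool (Vec.replicate n false) ≡ unary n
unary-size zero    = refl
unary-size (suc n) = cong (node leaf) (unary-size n)

-- The `case` of `program` splits the input, binding the universe size to index 0 and the list of
-- sets to index 1.
inputSlots : Slots [] 3
inputSlots = record { slot = λ () ; size = 0F ; system = 1F }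

program : Exp 1
program = case (var 0F) leaf (compile matrixT inputSlots)

module _ {n} (v₀ : Fin n) (𝒮 : SetSystem n) where

  open Packing v₀ 𝒮 (Algorithm.colouring (sets 𝒮)) (Greedy.colouring-proper (sets 𝒮))

  program-within : ∀ {X} → n ≤ X → length (sets 𝒮) ≤ X →
    encodeSystem 𝒮 ∷ [] ⊢ program ⇓ encodeMatrix matrix within 2 + time matrixT X
  program-within n≤X l≤X = case-node-within (var-within 0F refl)
    -- The denotation of `matrixT` unfolds to the rows `forUsed (entry v)` by computation, so only
    -- the encodings remain to be compared.
    (value-≡ (sym encode-matrix)
      (compile-within {s = inputSlots} {γ = λ ()} matrixT record
        { slot-≡ = λ () ; size-≡ = unary-size n ; system-≡ = refl }))
    where open Compilation (sets 𝒮) n≤X l≤X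

coordinate-bound : ∀ P → 2 ≤ P → let c = suc (P * P) in c * (c * (c * 3)) ≤ P ^ 11
coordinate-bound P 2≤P = begin
  c * (c * (c * 3))                    ≤⟨ ℕ.*-mono-≤ c≤ (ℕ.*-mono-≤ c≤ (ℕ.*-mono-≤ c≤ 3≤)) ⟩
  P ^ 3 * (P ^ 3 * (P ^ 3 * P ^ 2))    ≡⟨ cong (λ x → P ^ 3 * (P ^ 3 * x)) (ℕ.^-distribˡ-+-* P 3 2) ⟨
  P ^ 3 * (P ^ 3 * P ^ 5)              ≡⟨ cong (P ^ 3 *_) (ℕ.^-distribˡ-+-* P 3 5) ⟨
  P ^ 3 * P ^ 8                        ≡⟨ ℕ.^-distribˡ-+-* P 3 8 ⟨
  P ^ 11                               ∎
  where
  open ℕ.≤-Reasoning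
  c = suc (P * P)
  P²≡ : P * P ≡ P ^ 2
  P²≡ = cong (P *_) (sym (ℕ.*-identityʳ P))
  4≤ : 4 ≤ P * P
  4≤ = ℕ.*-mono-≤ 2≤P 2≤P
  3≤ : 3 ≤ P ^ 2
  3≤ = subst (3 ≤_) P²≡ (ℕ.≤-trans (ℕ.n≤1+n 3) 4≤)
  c≤ : c ≤ P ^ 3
  c≤ = begin
    1 + P * P        ≤⟨ ℕ.+-monoˡ-≤ (P * P) (ℕ.≤-trans (s≤s z≤n) 4≤) ⟩
    P * P + P * P    ≡⟨ cong (λ k → P * P + k) (ℕ.+-identityʳ (P * P)) ⟨
    2 * (P * P)      ≤⟨ ℕ.*-monoˡ-≤ (P * P) 2≤P ⟩
    P * (P * P)      ≡⟨ cong (P *_) P²≡ ⟩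
    P ^ 3            ∎

^-distribʳ-* : ∀ m n o → (m * n) ^ o ≡ m ^ o * n ^ o
^-distribʳ-* m n zero    = refl
^-distribʳ-* m n (suc o) = trans (cong (m * n *_) (^-distribʳ-* m n o))
  (ℕ.[m*n]*[o*p]≡[m*o]*[n*p] m n (m ^ o) (n ^ o))

polynomial-in-size : ∀ {f} → Polynomial f → ∃ λ d → ∀ n → 1 ≤ n → f (suc n * suc n) ≤ d * n ^ d
polynomial-in-size {f} (e , f≤) = d , λ { n@(suc _) 1≤n → begin
  f (suc n * suc n)            ≤⟨ f≤ (ℕ.≤-trans (s≤s (s≤s z≤n)) (ℕ.*-mono-≤ (s≤s 1≤n) (s≤s 1≤n))) ⟩
  (suc n * suc n) ^ e          ≤⟨ ℕ.^-monoˡ-≤ e (square n 1≤n) ⟩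
  (4 * n ^ 2) ^ e              ≡⟨ ^-distribʳ-* 4 (n ^ 2) e ⟩
  4 ^ e * (n ^ 2) ^ e          ≡⟨ cong (4 ^ e *_) (ℕ.^-*-assoc n 2 e) ⟩
  4 ^ e * n ^ (2 * e)          ≤⟨ ℕ.*-mono-≤ (ℕ.m≤m+n (4 ^ e) (2 * e))
                                   (ℕ.^-monoʳ-≤ n (ℕ.m≤n+m (2 * e) (4 ^ e))) ⟩
  d * n ^ d                    ∎ }
  where
  open ℕ.≤-Reasoning
  -- One number is both coefficient and exponent: (n + 1)² ≤ 4n² asks for 4^e as the former and 2e
  -- as the latter.
  d = 4 ^ e + 2 * e
  square : ∀ n → 1 ≤ n → suc n * suc n ≤ 4 * n ^ 2
  square n 1≤n = begin
    suc n * suc n        ≤⟨ ℕ.*-mono-≤ (ℕ.+-monoˡ-≤ n 1≤n) (ℕ.+-monoˡ-≤ n 1≤n) ⟩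
    (n + n) * (n + n)    ≡⟨ solve 1 (λ n → (n :+ n) :* (n :+ n) := con 4 :* (n :* (n :* con 1))) refl n ⟩
    4 * n ^ 2            ∎
    where open ℕSolver.+-*-Solver

theorem3p3 : ∃ λ (C : ℕ) → Σ (Exp 1) λ program → ∃ λ (d : ℕ) →
    ∀ (n : ℕ) → 1 ≤ n →
    ∀ (𝒮 : SetSystem n) (k Δ : ℕ) →
    Simple 𝒮 → NonTrivial 𝒮 → 2 ≤ k → SetsOfSize≤ k 𝒮 → Degree≤ Δ 𝒮 →
    PdimAtMost (𝒮 ↓) ((k * Δ) ^ C)
    ×
    (∃ λ (K : ℕ) → Σ (Vec (Vec BinaryFraction K) n) λ M → ∃ λ (t : ℕ) →
    1 ≤ K × K ≤ (k * Δ) ^ C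
    × (encodeSystem 𝒮 ∷ [] ⊢ program ⇓ encodeMatrix M ⟨ t ⟩)
    × t ≤ d * n ^ d
    × IsEmbedding (𝒮 ↓) (realMap M))
theorem3p3 = 11 , program , proj₁ bound ,
  λ { (suc m) 1≤n 𝒮 k Δ simple nontrivial 2≤k size≤k degree≤Δ →
    let open Packing {suc m} zero 𝒮 (Algorithm.colouring (sets 𝒮)) (Greedy.colouring-proper (sets 𝒮))
        K         = length coordinates
        1≤K       = ∈⇒length>0 (triples∈ zero zero zero)
        -- Some set contains element 0. Hence kΔ ≥ 2, so that constants can be absorbed into powers
        -- of kΔ.
        1≤Δ       = ℕ.≤-trans (1≤degree 𝒮 nontrivial) (degree≤Δ zero)
        2≤kΔ      = ℕ.*-mono-≤ 2≤k 1≤Δ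
        K≤        = ℕ.≤-trans
          (length-coordinates (suc (k * Δ * (k * Δ))) λ v → s≤s (subst (λ P → toℕ (Algorithm.colouring (sets 𝒮) v) ≤ P * P)
            (ℕ.*-comm Δ k) (colouring≤ 𝒮 size≤k degree≤Δ v)))
          (coordinate-bound (k * Δ) 2≤kΔ)
        embedding = matrix-isEmbedding simple nontrivial
        -- The bound (n + 1)² serves for n and for the number of sets at once.
        t , t≤ , run = program-within zero 𝒮 (ℕ.≤-trans (ℕ.n≤1+n (suc m)) (ℕ.m≤m*n (2 + m) (2 + m)))
                         (number-of-sets 𝒮 simple)
    in (K , 1≤K , K≤ , realMap matrix , embedding) ,
       (K , matrix , t , 1≤K , K≤ , run , ℕ.≤-trans t≤ (proj₂ bound (suc m) 1≤n) , embedding) }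
  where
  bound : ∃ λ d → ∀ n → 1 ≤ n → 2 + time matrixT (suc n * suc n) ≤ d * n ^ d
  bound = polynomial-in-size (+-poly (const-poly 2) (time-poly matrixT))

  1≤degree : ∀ {m} (𝒮 : SetSystem (suc m)) → NonTrivial 𝒮 → 1 ≤ degree 𝒮 zero
  1≤degree 𝒮 nontrivial = let A , A∈ , 0∈A = nontrivial zero in
    ∈⇒length>0 (Membership.∈-filter⁺ (zero Subset.∈?_) A∈ 0∈A)
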